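{- Let $p$ be a prime and let $r, s$ be integers with $p \nmid r$. Let $$S(p,r,s) = \{ j \in \{0,1,\ldots,p-1\} : j - s \equiv \tfrac12 r n(3n-1) \pmod p \text{ for some integer } n\}.$$ If $j \in \{1,2,\ldots,p-1-\max S(p,r,s)\}$, then $$\xi_{r,s}(p^{\lambda} m - j) \equiv 0 \pmod{p^{\lambda}}$$ for all positive integers $m$ and $\lambda$. Moreover, if $p \geq 5$ and $$\operatorname{digit}_1(s - r/24; p) \neq p-1,$$ then the same conclusion holds for all $j \in \{1,2,\ldots,p-1-\max S^{\ast}(p,r,s)\}$, where $S^{\ast}(p,r,s) = S(p,r,s) \setminus \{i_0\}$ and $i_0 \in \{0,1,\ldots,p-1\}$ is such that $i_0 - s \equiv -r/24 \pmod p$.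
   Context: For integers $r, s$, the numbers $\xi_{r,s}(n)$, $n \geq 0$, are defined by the identity of formal power series in $q$ $$\sum_{n \geq 0} \xi_{r,s}(n) q^n = (1-q)^s \sum_{n \geq 0} \prod_{j=1}^n \bigl(1 - (1-q)^{rj}\bigr),$$ where $(1-q)^k$ for negative $k$ is the usual power series expansion; the sum is well defined since the $n$-th summand is divisible by $q^n$. For $p \geq 5$ prime, the rational number $s - r/24$ is a $p$-adic integer and has a unique $p$-adic expansion $\sum_{k\geq 0} n_k p^k$ with $n_k \in \{0,1,\ldots,p-1\}$; $\operatorname{digit}_1(s-r/24;p)$ denotes the digit $n_1$. Also $-r/24$ modulo $p$ means the residue $x$ with $24x \equiv -r \pmod p$. -}

module Defs where

open import Data.Nat as ℕ using (ℕ; zero; suc; _<_; _≤_)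
open import Data.Nat.Combinatorics using (_C_)
open import Data.Integer as ℤ using (ℤ; +_; -[1+_]; _+_; _-_; _*_; -_)
open import Data.Integer.Divisibility using (_∣_)
open import Data.Product using (Σ; ∃; _×_)
open import Relation.Binary.PropositionalEquality using (_≢_)

Series : Set
Series = ℕ → ℤ

sumTo : ℕ → (ℕ → ℤ) → ℤ
sumTo zero    f = f 0
sumTo (suc n) f = sumTo n f + f (suc n)

_⊛_ : Series → Series → Series
(f ⊛ g) n = sumTo n (λ i → f i * g (n ℕ.∸ i))

oneS : Series
oneS zero    = + 1
oneS (suc _) = + 0

_⊖_ : Series → Series → Series
(f ⊖ g) n = f n - g n

neg1^ : ℕ → ℤ
neg1^ zero    = + 1
neg1^ (suc i) = - neg1^ i

-- (1 - q)^k for k ∈ ℤ (binomial series):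
--   k = a ≥ 0 : coefficient of q^i is (-1)^i (a choose i)
--   k = -(b+1): coefficient of q^i is (b+i choose i)
powOneMinusQ : ℤ → Series
powOneMinusQ (+ a)     i = neg1^ i * + (a C i)
powOneMinusQ -[1+ b ]  i = + ((b ℕ.+ i) C i)

prodT : ℤ → ℕ → Series
prodT r zero    = oneS
prodT r (suc k) = prodT r k ⊛ (oneS ⊖ powOneMinusQ (r * + suc k))

-- Σ_{k ≥ 0} T r k ; the k-th summand is divisible by q^k, so the
-- coefficient of q^d only receives contributions from k ≤ d.
sumT : ℤ → Series
sumT r d = sumTo d (λ k → prodT r k d)

ξ : ℤ → ℤ → ℕ → ℤ
ξ r s = powOneMinusQ s ⊛ sumT r

-- Generalised pentagonal numbers n(3n-1)/2 for n ∈ ℤ.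
pent : ℤ → ℤ
pent (+ n)     = + ((n ℕ.* (3 ℕ.* n ℕ.∸ 1)) ℕ./ 2)
pent -[1+ k ]  = + ((suc k ℕ.* (3 ℕ.* suc k ℕ.+ 1)) ℕ./ 2)

InS : ℕ → ℤ → ℤ → ℕ → Set
InS p r s j = j < p × ∃ λ (n : ℤ) → (+ p) ∣ ((+ j - s) - r * pent n)

IsMax : (ℕ → Set) → ℕ → Set
IsMax P M = P M × (∀ t → P t → t ≤ M)

-- i0 ∈ {0..p-1} with i0 - s ≡ -r/24 (mod p), i.e. 24 (i0 - s) + r ≡ 0 (mod p)
IsI0 : ℕ → ℤ → ℤ → ℕ → Set
IsI0 p r s i0 = i0 < p × (+ p) ∣ (+ 24 * (+ i0 - s) + r)

InS* : ℕ → ℤ → ℤ → ℕ → ℕ → Set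
InS* p r s i0 j = InS p r s j × j ≢ i0

-- d is digit_1 of the p-adic integer a / b (b a unit mod p):
-- there is a digit d0 with a/b ≡ d0 + d p (mod p²), d0, d ∈ {0..p-1}.
IsDigit1 : ℕ → ℤ → ℤ → ℕ → Set
IsDigit1 p a b d =
  d < p × ∃ λ (d0 : ℕ) → d0 < p × (+ (p ℕ.* p)) ∣ (a - b * + (d0 ℕ.+ d ℕ.* p))

Conclusion : ℕ → ℤ → ℤ → ℕ → Set
Conclusion p r s j =
  ∀ (m l : ℕ) → 1 ≤ m → 1 ≤ l →
    (+ (p ℕ.^ l)) ∣ ξ r s (p ℕ.^ l ℕ.* m ℕ.∸ j)

{-# OPTIONS --safe #-}
-- Write F(q) = Σₙ (1 - q)(1 - q²)⋯(1 - qⁿ), so that ξ r s is the series of q^{s/r} F(q) at q = (1 - X)^r.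
-- The sum S(z) = Σₙ (1 - z)(1 - q z)⋯(1 - qⁿ z) zⁿ satisfies S(z) = 1 - q z² - q² z³ S(q z).  Modulo
-- (pˡ, X^{D+1}) everything terminates and q^N = 1 for a large power N of the odd prime p.  Applying the
-- functional equation N times therefore leads back to S(z), and the derivative at z = 1 gives
--   4 F(q) = Σ_{n<N} (-1)ⁿ ((6n+5) q^{(n+1)(3n+2)/2} - (6n+1) q^{n(3n+1)/2}),
-- a finite form of Zagier's strange identity.  Its exponents x are the pentagonal numbers, and its
-- coefficients are ± w with w² = 24 x + 1.  So only the coefficients of w (1 - X)^a, a = s + r x, matter.
-- By (n + 1) c_{n+1} = (n - a) c_n, divisibility by pˡ descends from index pˡ m to pˡ m - j unless one of
-- a + 1, …, a + j is divisible by p, which the bound on j excludes.  In the exceptional class a ≡ i₀ the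
-- factor p of w pays for the single factor p lost in the descent, the digit condition excluding p².
module Submission where

open import Defs
open import Algebra.Bundles using (CommutativeRing)
open import Algebra.Solver.Ring.AlmostCommutativeRing using (fromCommutativeRing; _-Raw-AlmostCommutative⟶_)
open import Data.Empty using (⊥-elim)
open import Data.Integer as ℤ using (ℤ; +_; -[1+_])
import Data.Integer.DivMod as ℤ
open import Data.Integer.Divisibility using (_∣_)
open import Data.Integer.Divisibility.Signed as ∣ using () renaming (_∣_ to _∣ˢ_)
import Data.Integer.Properties as ℤ
open import Data.Integer.Tactic.RingSolver using (solve-∀)
open import Data.Maybe using (Maybe; just; nothing)
open import Data.Nat as ℕ using (ℕ; zero; suc; _≤_; _<_; _∸_; z≤n; s≤s)
open import Data.Nat.Combinatorics using (_C_; nCn≡1; nCk+nC[k+1]≡[n+1]C[k+1])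
import Data.Nat.DivMod as ℕ
import Data.Nat.Divisibility as ℕ
open import Data.Nat.Primality using (Prime; euclidsLemma; prime⇒nonZero; prime⇒nonTrivial; prime⇒irreducible)
import Data.Nat.Properties as ℕ
import Data.Nat.Tactic.RingSolver as ℕ-Solver
open import Data.Product using (_×_; _,_; ∃; proj₁; proj₂)
open import Data.Sum using (_⊎_; inj₁; inj₂; [_,_]′)
open import Function using (_∘_; id)
open import Level using (0ℓ; _⊔_)
open import Relation.Binary.PropositionalEquality as ≡ using (_≡_; _≢_; _≗_; cong; cong₂; subst)
open import Relation.Nullary using (¬_; yes; no)

-- Integer coefficients for the ring solver over an arbitrary commutative ring.

module IntegerCoefficients {c ℓ} (R : CommutativeRing c ℓ) where
  open CommutativeRing R
  open import Algebra.Properties.Ring ring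
    using (-‿distribˡ-*; -‿distribʳ-*; -‿involutive; -0#≈0#; -‿+-comm)
  open import Algebra.Properties.Semiring.Mult.TCOptimised semiring
    using (1+×; ×1-homo-*) renaming (_×_ to _·_; ×-homo-+ to ·-homo-+)
  open import Relation.Binary.Reasoning.Setoid setoid

  -- The canonical homomorphism from ℤ. The optimised multiple makes `⟦ + 1 ⟧` literally `1#`, so
  -- that `con (+ 1)` matches the `1#` of a goal.
  ⟦_⟧ : ℤ → Carrier
  ⟦ + n ⟧      = n · 1#
  ⟦ -[1+ n ] ⟧ = - (suc n · 1#)

  -‿homo : ∀ i → ⟦ ℤ.- i ⟧ ≈ - ⟦ i ⟧
  -‿homo (+ zero)   = sym -0#≈0#
  -‿homo (+ suc n)  = refl
  -‿homo (-[1+ n ]) = sym (-‿involutive _)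

  ⊖-homo : ∀ m n → ⟦ m ℤ.⊖ n ⟧ ≈ m · 1# - n · 1#
  ⊖-homo zero    zero    = sym (-‿inverseʳ 0#)
  ⊖-homo zero    (suc n) = sym (+-identityˡ _)
  ⊖-homo (suc m) zero    = sym (trans (+-congˡ -0#≈0#) (+-identityʳ _))
  ⊖-homo (suc m) (suc n) = begin
    ⟦ suc m ℤ.⊖ suc n ⟧                 ≡⟨ ≡.cong ⟦_⟧ (ℤ.[1+m]⊖[1+n]≡m⊖n m n) ⟩
    ⟦ m ℤ.⊖ n ⟧                         ≈⟨ ⊖-homo m n ⟩
    m · 1# - n · 1#                     ≈⟨ +-congʳ (+-identityʳ _) ⟨
    m · 1# + 0# - n · 1#                ≈⟨ +-congʳ (+-congˡ (-‿inverseʳ 1#)) ⟨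
    m · 1# + (1# - 1#) - n · 1#         ≈⟨ +-congʳ (+-assoc _ _ _) ⟨
    m · 1# + 1# - 1# - n · 1#           ≈⟨ +-congʳ (+-congʳ (+-comm _ _)) ⟩
    1# + m · 1# - 1# - n · 1#           ≈⟨ +-assoc _ _ _ ⟩
    1# + m · 1# + (- 1# - n · 1#)       ≈⟨ +-congˡ (-‿+-comm _ _) ⟩
    1# + m · 1# - (1# + n · 1#)         ≈⟨ +-cong (1+× m 1#) (-‿cong (1+× n 1#)) ⟨
    suc m · 1# - suc n · 1#             ∎

  +-homo : ∀ i j → ⟦ i ℤ.+ j ⟧ ≈ ⟦ i ⟧ + ⟦ j ⟧
  +-homo (+ m)    (+ n)    = ·-homo-+ 1# m n
  +-homo (+ m)    -[1+ n ] = ⊖-homo m (suc n)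
  +-homo -[1+ m ] (+ n)    = trans (⊖-homo n (suc m)) (+-comm _ _)
  +-homo -[1+ m ] -[1+ n ] = begin
    - (suc (suc (m ℕ.+ n)) · 1#)        ≡⟨ ≡.cong (λ k → - (suc k · 1#)) (ℕ.+-suc m n) ⟨
    - ((suc m ℕ.+ suc n) · 1#)          ≈⟨ -‿cong (·-homo-+ 1# (suc m) (suc n)) ⟩
    - (suc m · 1# + suc n · 1#)         ≈⟨ -‿+-comm _ _ ⟨
    - (suc m · 1#) - (suc n · 1#)       ∎

  ⁺*-homo : ∀ m j → ⟦ + m ℤ.* j ⟧ ≈ (m · 1#) * ⟦ j ⟧
  ⁺*-homo m (+ n) = begin
    ⟦ + m ℤ.* + n ⟧                     ≡⟨ ≡.cong ⟦_⟧ (ℤ.pos-* m n) ⟨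
    (m ℕ.* n) · 1#                      ≈⟨ ×1-homo-* m n ⟩
    (m · 1#) * (n · 1#)                 ∎
  ⁺*-homo m -[1+ n ] = begin
    ⟦ + m ℤ.* -[1+ n ] ⟧                ≡⟨ ≡.cong ⟦_⟧ (ℤ.neg-distribʳ-* (+ m) (+ suc n)) ⟨
    ⟦ ℤ.- (+ m ℤ.* + suc n) ⟧           ≈⟨ -‿homo (+ m ℤ.* + suc n) ⟩
    - ⟦ + m ℤ.* + suc n ⟧               ≈⟨ -‿cong (⁺*-homo m (+ suc n)) ⟩
    - ((m · 1#) * (suc n · 1#))         ≈⟨ -‿distribʳ-* _ _ ⟩
    (m · 1#) * - (suc n · 1#)           ∎

  *-homo : ∀ i j → ⟦ i ℤ.* j ⟧ ≈ ⟦ i ⟧ * ⟦ j ⟧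
  *-homo (+ m)    j = ⁺*-homo m j
  *-homo -[1+ m ] j = begin
    ⟦ -[1+ m ] ℤ.* j ⟧                  ≡⟨ ≡.cong ⟦_⟧ (ℤ.neg-distribˡ-* (+ suc m) j) ⟨
    ⟦ ℤ.- (+ suc m ℤ.* j) ⟧             ≈⟨ -‿homo (+ suc m ℤ.* j) ⟩
    - ⟦ + suc m ℤ.* j ⟧                 ≈⟨ -‿cong (⁺*-homo (suc m) j) ⟩
    - ((suc m · 1#) * ⟦ j ⟧)            ≈⟨ -‿distribˡ-* _ _ ⟩
    - (suc m · 1#) * ⟦ j ⟧              ∎

  morphism : ℤ.+-*-rawRing -Raw-AlmostCommutative⟶ fromCommutativeRing R
  morphism = record
    { ⟦_⟧ = ⟦_⟧ ; +-homo = +-homo ; *-homo = *-homo ; -‿homo = -‿homo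
    ; 0-homo = refl ; 1-homo = refl }

  coefficients-equal? : ∀ i j → Maybe (⟦ i ⟧ ≈ ⟦ j ⟧)
  coefficients-equal? i j with i ℤ.≟ j
  ... | yes eq = just (reflexive (≡.cong ⟦_⟧ eq))
  ... | no _   = nothing

  open import Algebra.Solver.Ring ℤ.+-*-rawRing (fromCommutativeRing R) morphism coefficients-equal? public
    using (solve; _:=_; _:+_; _:*_; _:-_; :-_; con)

-- Sums of q-Pochhammer symbols in a commutative ring

module Pochhammer {c ℓ} (R : CommutativeRing c ℓ) (q : CommutativeRing.Carrier R) where
  open CommutativeRing R
  open import Algebra.Properties.Semiring.Exp semiring using (_^_)
  open import Algebra.Properties.CommutativeSemiring.Exp commutativeSemiring using (^-distrib-*)
  open import Relation.Binary.Reasoning.Setoid setoid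
  open IntegerCoefficients R

  -- The q-Pochhammer symbol (x; q)ₙ.
  ⟨_⟩_ : Carrier → ℕ → Carrier
  ⟨ x ⟩ zero  = 1#
  ⟨ x ⟩ suc n = ⟨ x ⟩ n * (1# - x * q ^ n)

  ∑< : ℕ → (ℕ → Carrier) → Carrier
  ∑< zero    f = 0#
  ∑< (suc n) f = ∑< n f + f n

  ∑<-cong : ∀ n {f g} → (∀ i → f i ≈ g i) → ∑< n f ≈ ∑< n g
  ∑<-cong zero    f≈g = refl
  ∑<-cong (suc n) f≈g = +-cong (∑<-cong n f≈g) (f≈g n)

  ⟨⟩-cong : ∀ {x y} n → x ≈ y → ⟨ x ⟩ n ≈ ⟨ y ⟩ n
  ⟨⟩-cong zero    x≈y = refl
  ⟨⟩-cong (suc n) x≈y = *-cong (⟨⟩-cong n x≈y) (+-congˡ (-‿cong (*-congʳ x≈y)))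

  ⟨⟩-shift : ∀ x n → (1# - x) * ⟨ q * x ⟩ n ≈ ⟨ x ⟩ suc n
  ⟨⟩-shift x zero = solve 1 (λ x → (con (+ 1) :- x) :* con (+ 1) := con (+ 1) :* (con (+ 1) :- x :* con (+ 1))) refl x
  ⟨⟩-shift x (suc n) = begin
    (1# - x) * (⟨ q * x ⟩ n * (1# - q * x * q ^ n))  ≈⟨ *-assoc _ _ _ ⟨
    (1# - x) * ⟨ q * x ⟩ n * (1# - q * x * q ^ n)    ≈⟨ *-cong (⟨⟩-shift x n) (+-congˡ (-‿cong (trans (*-congʳ (*-comm q x)) (*-assoc x q _)))) ⟩
    (⟨ x ⟩ suc n) * (1# - x * (q * q ^ n))           ∎

  -- Pulling the factor 1 - z out of `S` shows that `S` vanishes at z = 1, where minus its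
  -- derivative is `T`; and `T K` at z = 1 is a partial sum of F(q).
  T S : ℕ → Carrier → Carrier
  T K z = ∑< K (λ n → ⟨ q * z ⟩ n * z ^ n)
  S K z = (1# - z) * T K z

  ^-cong : ∀ {x y} n → x ≈ y → x ^ n ≈ y ^ n
  ^-cong zero    x≈y = refl
  ^-cong (suc n) x≈y = *-cong x≈y (^-cong n x≈y)

  S-cong : ∀ K {x y} → x ≈ y → S K x ≈ S K y
  S-cong K x≈y = *-cong (+-congˡ (-‿cong x≈y))
    (∑<-cong K (λ n → *-cong (⟨⟩-cong n (*-congˡ x≈y)) (^-cong n x≈y)))

  -- In the additional summand the prefactor 1 - q z completes the symbol with base q² z to one with
  -- base q z, the base that occurs in `T K z`.
  S-shift : ∀ K z → S (suc K) (q * z) ≈ S K (q * z) + (⟨ q * z ⟩ suc K) * (q ^ K * z ^ K)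
  S-shift K z = begin
    (1# - q * z) * (T K (q * z) + ⟨ q * (q * z) ⟩ K * (q * z) ^ K)
      ≈⟨ distribˡ _ _ _ ⟩
    S K (q * z) + (1# - q * z) * (⟨ q * (q * z) ⟩ K * (q * z) ^ K)
      ≈⟨ +-congˡ (*-assoc _ _ _) ⟨
    S K (q * z) + (1# - q * z) * ⟨ q * (q * z) ⟩ K * (q * z) ^ K
      ≈⟨ +-congˡ (*-cong (⟨⟩-shift (q * z) K) (^-distrib-* q z K)) ⟩
    S K (q * z) + (⟨ q * z ⟩ suc K) * (q ^ K * z ^ K) ∎

  -- The summand with z ^ K is the boundary term of S(z) = 1 - q z² - q² z³ S(q z); it disappears
  -- once the Pochhammer symbols vanish.
  S-functional : ∀ K z →
    S K z + q * q * (z * z * z) * S K (q * z)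
      + z ^ K * ((1# - z) * ⟨ q * z ⟩ K + z * ⟨ q * z ⟩ suc K)
    ≈ 1# - q * (z * z)
  S-functional zero z =
    solve 2 (λ q z → (con (+ 1) :- z) :* con (+ 0) :+ q :* q :* (z :* z :* z) :* ((con (+ 1) :- q :* z) :* con (+ 0))
        :+ con (+ 1) :* ((con (+ 1) :- z) :* con (+ 1) :+ z :* (con (+ 1) :* (con (+ 1) :- q :* z :* con (+ 1))))
        := con (+ 1) :- q :* (z :* z)) refl q z
  S-functional (suc K) z = begin
    S (suc K) z + q * q * (z * z * z) * S (suc K) (q * z)
      + z ^ suc K * ((1# - z) * (⟨ q * z ⟩ suc K) + z * ⟨ q * z ⟩ suc (suc K))
      ≈⟨ +-congʳ (+-congˡ (*-congˡ (S-shift K z))) ⟩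
    S (suc K) z + q * q * (z * z * z) * (S K (q * z) + (⟨ q * z ⟩ suc K) * (q ^ K * z ^ K))
      + z ^ suc K * ((1# - z) * (⟨ q * z ⟩ suc K) + z * ⟨ q * z ⟩ suc (suc K))
      ≈⟨ solve 7 (λ q z t s b qᴷ zᴷ →
           let b′ = b :* (con (+ 1) :- q :* z :* qᴷ) in
           (con (+ 1) :- z) :* (t :+ b :* zᴷ) :+ q :* q :* (z :* z :* z) :* (s :+ b′ :* (qᴷ :* zᴷ))
             :+ z :* zᴷ :* ((con (+ 1) :- z) :* b′ :+ z :* (b′ :* (con (+ 1) :- q :* z :* (q :* qᴷ))))
           := (con (+ 1) :- z) :* t :+ q :* q :* (z :* z :* z) :* s
             :+ zᴷ :* ((con (+ 1) :- z) :* b :+ z :* b′))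
           refl q z (T K z) (S K (q * z)) (⟨ q * z ⟩ K) (q ^ K) (z ^ K) ⟩
    S K z + q * q * (z * z * z) * S K (q * z)
      + z ^ K * ((1# - z) * ⟨ q * z ⟩ K + z * ⟨ q * z ⟩ suc K)
      ≈⟨ S-functional K z ⟩
    1# - q * (z * z) ∎

  -- Both boundary terms contain the factor `⟨ q * z ⟩ K`, so the functional equation becomes exact.
  S-step : ∀ K z → ⟨ q * z ⟩ K ≈ 0# → S K z ≈ 1# - q * (z * z) - q * q * (z * z * z) * S K (q * z)
  S-step K z vanishes = begin
    S K z
      ≈⟨ solve 5 (λ z s t zᴷ f → s := s :+ t
           :+ zᴷ :* ((con (+ 1) :- z) :* con (+ 0) :+ z :* (con (+ 0) :* f)) :- t) refl
           z (S K z) (q * q * (z * z * z) * S K (q * z)) (z ^ K) (1# - q * z * q ^ K) ⟩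
    S K z + q * q * (z * z * z) * S K (q * z)
      + z ^ K * ((1# - z) * 0# + z * (0# * (1# - q * z * q ^ K))) - q * q * (z * z * z) * S K (q * z)
      ≈⟨ +-congʳ (+-congˡ (*-congˡ (+-cong (*-congˡ vanishes) (*-congˡ (*-congʳ vanishes))))) ⟨
    S K z + q * q * (z * z * z) * S K (q * z)
      + z ^ K * ((1# - z) * ⟨ q * z ⟩ K + z * ⟨ q * z ⟩ suc K) - q * q * (z * z * z) * S K (q * z)
      ≈⟨ +-congʳ (S-functional K z) ⟩
    1# - q * (z * z) - q * q * (z * z * z) * S K (q * z) ∎

  module _ (z : Carrier) where
    -- The state after n applications of the functional equation: the argument qⁿ z, and the product
    -- of the factors - q² zₖ³ for k < n.
    zₙ w : ℕ → Carrier
    zₙ zero    = z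
    zₙ (suc n) = q * zₙ n
    w zero    = 1#
    w (suc n) = - (w n * (q * q * (zₙ n * zₙ n * zₙ n)))

    S-iterate : ∀ K → (∀ n → ⟨ q * zₙ n ⟩ K ≈ 0#) → ∀ n →
      S K z ≈ ∑< n (λ k → w k * (1# - q * (zₙ k * zₙ k))) + w n * S K (zₙ n)
    S-iterate K vanishes zero = sym (trans (+-identityˡ _) (*-identityˡ _))
    S-iterate K vanishes (suc n) = begin
      S K z
        ≈⟨ S-iterate K vanishes n ⟩
      ∑< n f + w n * S K (zₙ n)
        ≈⟨ +-congˡ (*-congˡ (S-step K (zₙ n) (vanishes n))) ⟩
      ∑< n f + w n * (1# - q * (zₙ n * zₙ n) - q * q * (zₙ n * zₙ n * zₙ n) * S K (q * zₙ n))
        ≈⟨ solve 5 (λ p w a b s → p :+ w :* (a :- b :* s) := p :+ w :* a :+ (:- (w :* b)) :* s) refl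
             (∑< n f) (w n) (1# - q * (zₙ n * zₙ n)) (q * q * (zₙ n * zₙ n * zₙ n)) (S K (q * zₙ n)) ⟩
      ∑< (suc n) f + w (suc n) * S K (zₙ (suc n)) ∎
      where
      f : ℕ → Carrier
      f k = w k * (1# - q * (zₙ k * zₙ k))

-- Dual numbers: the pair (a , b) stands for a + b ε with ε² = 0.

module DualNumbers {c ℓ} (R : CommutativeRing c ℓ) where
  open CommutativeRing R
  open IntegerCoefficients R

  Dual : CommutativeRing c ℓ
  Dual = record
    { Carrier = Carrier × Carrier
    ; _≈_ = λ (a , b) (a′ , b′) → (a ≈ a′) × (b ≈ b′)
    ; _+_ = λ (a , b) (a′ , b′) → a + a′ , b + b′
    ; _*_ = λ (a , b) (a′ , b′) → a * a′ , a * b′ + b * a′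
    ; -_ = λ (a , b) → - a , - b
    ; 0# = 0# , 0#
    ; 1# = 1# , 0#
    ; isCommutativeRing = record
      { isRing = record
        { +-isAbelianGroup = record
          { isGroup = record
            { isMonoid = record
              { isSemigroup = record
                { isMagma = record
                  { isEquivalence = record
                    { refl = refl , refl
                    ; sym = λ (p , q) → sym p , sym q
                    ; trans = λ (p , q) (p′ , q′) → trans p p′ , trans q q′ }
                  ; ∙-cong = λ (p , q) (p′ , q′) → +-cong p p′ , +-cong q q′ }
                ; assoc = λ _ _ _ → +-assoc _ _ _ , +-assoc _ _ _ }
              ; identity = (λ _ → +-identityˡ _ , +-identityˡ _) , (λ _ → +-identityʳ _ , +-identityʳ _) }
            ; inverse = (λ _ → -‿inverseˡ _ , -‿inverseˡ _) , (λ _ → -‿inverseʳ _ , -‿inverseʳ _)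
            ; ⁻¹-cong = λ (p , q) → -‿cong p , -‿cong q }
          ; comm = λ _ _ → +-comm _ _ , +-comm _ _ }
        ; *-cong = λ (p , q) (p′ , q′) → *-cong p p′ , +-cong (*-cong p q′) (*-cong q p′)
        ; *-assoc = λ (a , b) (a′ , b′) (a″ , b″) → *-assoc _ _ _ ,
            solve 6 (λ a b a′ b′ a″ b″ →
              a :* a′ :* b″ :+ (a :* b′ :+ b :* a′) :* a″
              := a :* (a′ :* b″ :+ b′ :* a″) :+ b :* (a′ :* a″)) refl a b a′ b′ a″ b″
        ; *-identity =
            (λ (a , b) → *-identityˡ _ ,
              solve 2 (λ a b → con (+ 1) :* b :+ con (+ 0) :* a := b) refl a b) ,
            (λ (a , b) → *-identityʳ _ ,
              solve 2 (λ a b → a :* con (+ 0) :+ b :* con (+ 1) := b) refl a b)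
        ; distrib =
            (λ (a , b) (a′ , b′) (a″ , b″) → distribˡ _ _ _ ,
              solve 6 (λ a b a′ b′ a″ b″ →
                a :* (b′ :+ b″) :+ b :* (a′ :+ a″)
                := (a :* b′ :+ b :* a′) :+ (a :* b″ :+ b :* a″)) refl a b a′ b′ a″ b″) ,
            (λ (a , b) (a′ , b′) (a″ , b″) → distribʳ _ _ _ ,
              solve 6 (λ a b a′ b′ a″ b″ →
                (a′ :+ a″) :* b :+ (b′ :+ b″) :* a
                := (a′ :* b :+ b′ :* a) :+ (a″ :* b :+ b″ :* a)) refl a b a′ b′ a″ b″)
        }
      ; *-comm = λ (a , b) (a′ , b′) → *-comm _ _ ,
          solve 4 (λ a b a′ b′ → a :* b′ :+ b :* a′ := a′ :* b :+ b′ :* a) refl a b a′ b′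
      }
    }

-- Divisibility by powers of a ring element.

module PowersOf {c ℓ} (R : CommutativeRing c ℓ) (h : CommutativeRing.Carrier R) where
  open CommutativeRing R
  open import Algebra.Properties.Semiring.Exp semiring using (_^_)
  open import Relation.Binary.Reasoning.Setoid setoid
  open IntegerCoefficients R

  record O (n : ℕ) (x : Carrier) : Set (c ⊔ ℓ) where
    constructor multiple
    field
      quotient : Carrier
      equality : x ≈ h ^ n * quotient

  O-resp-≈ : ∀ {n x y} → x ≈ y → O n x → O n y
  O-resp-≈ x≈y (multiple a p) = multiple a (trans (sym x≈y) p)

  O0 : ∀ x → O 0 x
  O0 x = multiple x (sym (*-identityˡ x))

  O-+ : ∀ {n x y} → O n x → O n y → O n (x + y)
  O-+ (multiple a p) (multiple b q) = multiple (a + b) (trans (+-cong p q) (sym (distribˡ _ _ _)))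

  O-*ʳ : ∀ {n x} y → O n x → O n (x * y)
  O-*ʳ y (multiple a p) = multiple (a * y) (trans (*-congʳ p) (*-assoc _ _ _))

  O-*-O1 : ∀ {n x y} → O n x → O 1 y → O (suc n) (x * y)
  O-*-O1 {n} {x} {y} (multiple a p) (multiple b q) = multiple (a * b) (begin
    x * y                     ≈⟨ *-cong p q ⟩
    h ^ n * a * (h * 1# * b)  ≈⟨ solve 4 (λ h s a b → s :* a :* (h :* con (+ 1) :* b) := h :* s :* (a :* b)) refl h (h ^ n) a b ⟩
    h ^ suc n * (a * b)       ∎)

  O-vanish : ∀ {n x} → h ^ n ≈ 0# → O n x → x ≈ 0#
  O-vanish hⁿ≈0 (multiple a p) = trans p (trans (*-congʳ hⁿ≈0) (zeroˡ a))

  module _ (q : Carrier) (q≡1 : O 1 (1# - q)) where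
    open Pochhammer R q

    O-1-q^ : ∀ k → O 1 (1# - q ^ k)
    O-1-q^ zero    = multiple 0# (trans (-‿inverseʳ 1#) (sym (zeroʳ _)))
    O-1-q^ (suc k) = O-resp-≈
      (solve 2 (λ q s → (con (+ 1) :- s) :+ (con (+ 1) :- q) :* s := con (+ 1) :- q :* s) refl q (q ^ k))
      (O-+ (O-1-q^ k) (O-*ʳ (q ^ k) q≡1))

    -- Each of the n factors 1 - qᵏ is a multiple of 1 - q and hence of `h`.
    O-⟨q⟩ : ∀ n → O n (⟨ q ⟩ n)
    O-⟨q⟩ zero    = O0 1#
    O-⟨q⟩ (suc n) = O-*-O1 (O-⟨q⟩ n) (O-1-q^ (suc n))

-- Only additive closure is asked for: the property that one given coefficient of a series is
-- divisible by m does not survive multiplication by other series.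
record IsSubgroup {c ℓ g} (R : CommutativeRing c ℓ) (G : CommutativeRing.Carrier R → Set g) : Set (c ⊔ ℓ ⊔ g) where
  open CommutativeRing R
  field
    resp : ∀ {x y} → x ≈ y → G x → G y
    0∈   : G 0#
    +∈   : ∀ {x y} → G x → G y → G (x + y)
    -∈   : ∀ {x} → G x → G (- x)

-- The exponents n(3n+1)/2 and (n+1)(3n+2)/2.

e : ℕ → ℕ
e zero    = 0
e (suc n) = e n ℕ.+ (3 ℕ.* n ℕ.+ 2)

-- The exponent (n+1)(3n+2)/2, which goes with the coefficient 6n+5. The increment 2n+1 comes from
-- the factor q (qⁿ)² of the inhomogeneous term 1 - q z².
e₅ : ℕ → ℕ
e₅ n = e n ℕ.+ (1 ℕ.+ (n ℕ.+ n))

e-closed : ∀ n → 2 ℕ.* e n ≡ n ℕ.* (3 ℕ.* n ℕ.+ 1)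
e-closed zero    = ≡.refl
e-closed (suc n) = ≡.trans (ℕ.*-distribˡ-+ 2 (e n) _) (≡.trans (cong (ℕ._+ 2 ℕ.* (3 ℕ.* n ℕ.+ 2)) (e-closed n)) (step n))
  where
  step : ∀ n → n ℕ.* (3 ℕ.* n ℕ.+ 1) ℕ.+ 2 ℕ.* (3 ℕ.* n ℕ.+ 2) ≡ suc n ℕ.* (3 ℕ.* suc n ℕ.+ 1)
  step = ℕ-Solver.solve-∀

-- For odd n the factor 3n+1 is even, so the exponent is a multiple of n, and qⁿ = 1 makes the
-- corresponding power of q trivial.
e-odd : ∀ k → e (1 ℕ.+ 2 ℕ.* k) ≡ (1 ℕ.+ 2 ℕ.* k) ℕ.* (3 ℕ.* k ℕ.+ 2)
e-odd k = ℕ.*-cancelˡ-≡ _ _ 2 (≡.trans (e-closed (1 ℕ.+ 2 ℕ.* k)) (double k))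
  where
  double : ∀ k → (1 ℕ.+ 2 ℕ.* k) ℕ.* (3 ℕ.* (1 ℕ.+ 2 ℕ.* k) ℕ.+ 1) ≡ 2 ℕ.* ((1 ℕ.+ 2 ℕ.* k) ℕ.* (3 ℕ.* k ℕ.+ 2))
  double = ℕ-Solver.solve-∀

-- Iterating the functional equation of S over a full period of q, at z = 1 - ε with ε² = 0;
-- the coefficient of ε in S K (1 - ε) is the value of T K at z = 1.
module Strange {c ℓ} (R : CommutativeRing c ℓ) (q h : CommutativeRing.Carrier R) where
  open CommutativeRing R
  open import Algebra.Properties.Ring ring using (-‿distribˡ-*; -‿involutive)
  open import Algebra.Properties.Semiring.Exp semiring using (_^_; ^-homo-*; ^-assocʳ; ^-congˡ)
  open import Algebra.Properties.Semiring.Mult semiring using (×-homo-+; ×1-homo-*) renaming (_×_ to _·_)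
  open import Relation.Binary.Reasoning.Setoid setoid
  open IntegerCoefficients R
  open DualNumbers R
  open PowersOf R h
  open Pochhammer R q

  private module D = CommutativeRing Dual
  open import Algebra.Properties.Semiring.Exp D.semiring using () renaming (_^_ to _^ᴰ_)

  q̂ ẑ : D.Carrier
  q̂ = q , 0#
  ẑ = 1# , - 1#

  private module P = Pochhammer Dual q̂

  -- Here the multiple is the unoptimised one, unfolding to 1# + (1# + ⋯ + 0#); the solver
  -- expressions `two`, `three`, ... spell out this shape.
  ν : ℕ → Carrier
  ν n = n · 1#

  q̂^ : ∀ n → q̂ ^ᴰ n D.≈ (q ^ n , 0#)
  q̂^ zero    = D.refl
  q̂^ (suc n) = D.trans (D.*-congˡ (q̂^ n))
    (refl , solve 2 (λ q s → q :* con (+ 0) :+ con (+ 0) :* s := con (+ 0)) refl q (q ^ n))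

  ẑₙ : ∀ n → P.zₙ ẑ n D.≈ (q ^ n , - (q ^ n))
  ẑₙ zero    = D.refl
  ẑₙ (suc n) = D.trans (D.*-congˡ (ẑₙ n))
    (refl , solve 2 (λ q s → q :* (:- s) :+ con (+ 0) :* s := :- (q :* s)) refl q (q ^ n))

  u : ℕ → Carrier
  u zero    = 1#
  u (suc n) = - (u n * (q * q * (q ^ n * q ^ n * q ^ n)))

  -- Every step contributes the cube of 1 - ε, and (1 - ε)³ⁿ = 1 - 3n ε.
  ŵ : ∀ n → P.w ẑ n D.≈ (u n , - (ν 3 * ν n * u n))
  ŵ zero = refl , solve 0 (con (+ 0) := :- ((con (+ 1) :+ (con (+ 1) :+ (con (+ 1) :+ con (+ 0)))) :* con (+ 0) :* con (+ 1))) refl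
  ŵ (suc n) = D.trans (D.-‿cong (D.*-cong (ŵ n) (D.*-congˡ (D.*-cong (D.*-cong (ẑₙ n) (ẑₙ n)) (ẑₙ n)))))
    (refl , solve 4 (λ q s u k →
      let three = con (+ 1) :+ (con (+ 1) :+ (con (+ 1) :+ con (+ 0)))
          z² = s :* s
          dz² = s :* (:- s) :+ (:- s) :* s
          z³ = z² :* s
          dz³ = z² :* (:- s) :+ dz² :* s
          dq² = q :* con (+ 0) :+ con (+ 0) :* q
          a = q :* q :* z³
          da = q :* q :* dz³ :+ dq² :* z³ in
      :- (u :* da :+ (:- (three :* k :* u)) :* a)
      := :- (three :* (con (+ 1) :+ k) :* (:- (u :* a)))) refl q (q ^ n) (u n) (ν n))

  -- By the Leibniz rule the ε-part of a product of n multiples of h is only a multiple of hⁿ⁻¹.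
  O² : ℕ → D.Carrier → Set _
  O² n (x , y) = O n x × O (ℕ.pred n) y

  O²-* : ∀ n {x y} → O² n x → O 1 (proj₁ y) → O² (suc n) (x D.* y)
  O²-* zero    (p , _) r = O-*-O1 p r , O0 _
  O²-* (suc n) {x} {y} (p , p′) r = O-*-O1 p r , O-+ (O-*ʳ (proj₂ y) p) (O-*-O1 p′ r)

  module _ (q≡1 : O 1 (1# - q)) where
    O²-pochhammer : ∀ k n → O² n (P.⟨ q̂ D.* P.zₙ ẑ k ⟩ n)
    O²-pochhammer k zero    = O0 _ , O0 _
    O²-pochhammer k (suc n) = O²-* n (O²-pochhammer k n)
      (O-resp-≈ (+-congˡ (-‿cong (begin
        q ^ (suc k ℕ.+ n)                      ≈⟨ ^-homo-* q (suc k) n ⟩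
        q * q ^ k * q ^ n                      ≈⟨ *-cong (*-congˡ (proj₁ (ẑₙ k))) (proj₁ (q̂^ n)) ⟨
        q * proj₁ (P.zₙ ẑ k) * proj₁ (q̂ ^ᴰ n)  ∎)))
      (O-1-q^ q q≡1 (suc k ℕ.+ n)))

    -- K + 1 factors are taken although hᴷ = 0, because the ε-part loses one power of h.
    vanishing : ∀ K → h ^ K ≈ 0# → ∀ k → P.⟨ q̂ D.* P.zₙ ẑ k ⟩ suc K D.≈ D.0#
    vanishing K hᴷ≈0 k with O²-pochhammer k (suc K)
    ... | p , p′ = O-vanish (trans (*-congˡ hᴷ≈0) (zeroʳ h)) p , O-vanish hᴷ≈0 p′

  first-⟨⟩ : ∀ n → proj₁ (P.⟨ q̂ D.* ẑ ⟩ n) ≈ ⟨ q ⟩ n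
  first-⟨⟩ zero    = refl
  first-⟨⟩ (suc n) = *-cong (first-⟨⟩ n) (+-congˡ (-‿cong (*-cong (*-identityʳ q) (proj₁ (q̂^ n)))))

  first-ẑ^ : ∀ n → proj₁ (ẑ ^ᴰ n) ≈ 1#
  first-ẑ^ zero    = refl
  first-ẑ^ (suc n) = trans (*-identityˡ _) (first-ẑ^ n)

  first-T : ∀ K → proj₁ (P.T K ẑ) ≈ ∑< K ⟨ q ⟩_
  first-T zero    = refl
  first-T (suc K) = +-cong (first-T K)
    (trans (*-cong (first-⟨⟩ K) (first-ẑ^ K)) (*-identityʳ _))

  -- The prefactor 1 - z is ε, which leaves ε times the value of `T` at ε = 0.
  S-ẑ : ∀ K → P.S K ẑ D.≈ (0# , ∑< K ⟨ q ⟩_)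
  S-ẑ K = trans (*-congʳ (-‿inverseʳ 1#)) (zeroˡ _) ,
    trans (solve 2 (λ t t′ → (con (+ 1) :- con (+ 1)) :* t′ :+ (con (+ 0) :- (:- con (+ 1))) :* t := t) refl
             (proj₁ (P.T K ẑ)) (proj₂ (P.T K ẑ)))
          (first-T K)

  p₁ p₂ : ℕ → Carrier
  p₁ k = u k * (1# - q * (q ^ k * q ^ k))
  p₂ k = u k * ((ν 3 * ν k + ν 2) * (q * (q ^ k * q ^ k)) - ν 3 * ν k)

  partial-theta : ∀ n → P.∑< n (λ k → P.w ẑ k D.* (D.1# D.- q̂ D.* (P.zₙ ẑ k D.* P.zₙ ẑ k))) D.≈ (∑< n p₁ , ∑< n p₂)
  partial-theta zero    = D.refl
  partial-theta (suc n) = D.+-cong (partial-theta n) (D.trans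
    (D.*-cong (ŵ n) (D.+-congˡ (D.-‿cong (D.*-congˡ (D.*-cong (ẑₙ n) (ẑₙ n))))))
    (refl , solve 4 (λ q s u k →
      let two = con (+ 1) :+ (con (+ 1) :+ con (+ 0))
          three = con (+ 1) :+ two in
      u :* (con (+ 0) :- (q :* (s :* (:- s) :+ (:- s) :* s) :+ con (+ 0) :* (s :* s)))
        :+ (:- (three :* k :* u)) :* (con (+ 1) :- q :* (s :* s))
      := u :* ((three :* k :+ two) :* (q :* (s :* s)) :- three :* k)) refl q (q ^ n) (u n) (ν n)))

  θ : ℕ → Carrier
  θ k = u k * ((ν 6 * ν k + ν 5) * (q * (q ^ k * q ^ k)) - (ν 6 * ν k + 1#))

  -- After N steps the argument is z again and the accumulated factor is -1 + c ε. As S = ε F, the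
  -- term c ε S vanishes, so S equals the theta sum minus S; comparing both components gives 2 F = ∑
  -- `p₂` and ∑ `p₁` = 0.
  strange-identity : ∀ K N → O 1 (1# - q) → h ^ K ≈ 0# → q ^ N ≈ 1# → u N ≈ - 1# →
    ν 4 * ∑< (suc K) ⟨ q ⟩_ ≈
    ∑< N θ
  strange-identity K N q≡1 hᴷ≈0 qᴺ≈1 uᴺ≈-1 = begin
    ν 4 * F
      ≈⟨ solve 1 (λ f →
           let two = con (+ 1) :+ (con (+ 1) :+ con (+ 0)) in
           (con (+ 1) :+ (con (+ 1) :+ two)) :* f := two :* (f :- (:- con (+ 1)) :* f)) refl F ⟩
    ν 2 * (F - - 1# * F)
      ≈⟨ *-congˡ (trans (+-congʳ (proj₂ closed)) (solve 4 (λ a m f c → a :+ (m :* f :+ c :* con (+ 0)) :- m :* f := a) refl (∑< N p₂) (- 1#) F (- (ν 3 * ν N * u N)))) ⟩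
    ν 2 * ∑< N p₂
      -- Subtracting the sum of `p₁`, which is zero, turns the doubled coefficients 6k+4 and 6k into
      -- 6k+5 and 6k+1, the square roots of 24 times the exponent plus 1.
      ≈⟨ trans (+-congˡ (-‿cong p₁≈0)) (solve 1 (λ a → a :- con (+ 0) := a) refl _) ⟨
    ν 2 * ∑< N p₂ - ∑< N p₁
      ≈⟨ combine N ⟩
    ∑< N θ ∎
    where
    F = ∑< (suc K) ⟨ q ⟩_
    closed : (0# , F) D.≈ (∑< N p₁ , ∑< N p₂) D.+ (- 1# , - (ν 3 * ν N * u N)) D.* (0# , F)
    closed = D.trans (D.sym (S-ẑ (suc K))) (D.trans
      (P.S-iterate ẑ (suc K) (vanishing q≡1 K hᴷ≈0) N)
      (D.+-cong (partial-theta N) (D.*-cong (D.trans (ŵ N) (uᴺ≈-1 , refl))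
        (D.trans (P.S-cong (suc K) (D.trans (ẑₙ N) (qᴺ≈1 , -‿cong qᴺ≈1))) (S-ẑ (suc K))))))
    p₁≈0 : ∑< N p₁ ≈ 0#
    p₁≈0 = sym (trans (proj₁ closed) (solve 1 (λ a → a :+ (:- con (+ 1)) :* con (+ 0) := a) refl _))
    combine : ∀ n → ν 2 * ∑< n p₂ - ∑< n p₁ ≈ ∑< n θ
    combine zero = solve 0 ((con (+ 1) :+ (con (+ 1) :+ con (+ 0))) :* con (+ 0) :- con (+ 0) := con (+ 0)) refl
    combine (suc n) = begin
      ν 2 * (∑< n p₂ + p₂ n) - (∑< n p₁ + p₁ n)
        ≈⟨ solve 5 (λ t a b c d → t :* (a :+ b) :- (c :+ d) := t :* a :- c :+ (t :* b :- d)) refl (ν 2) _ _ _ _ ⟩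
      ν 2 * ∑< n p₂ - ∑< n p₁ + (ν 2 * p₂ n - p₁ n)
        ≈⟨ +-cong (combine n) (solve 3 (λ u k s →
             let two = con (+ 1) :+ (con (+ 1) :+ con (+ 0))
                 three = con (+ 1) :+ two
                 five = con (+ 1) :+ (con (+ 1) :+ three)
                 six = con (+ 1) :+ five in
             two :* (u :* ((three :* k :+ two) :* s :- three :* k)) :- u :* (con (+ 1) :- s)
             := u :* ((six :* k :+ five) :* s :- (six :* k :+ con (+ 1)))) refl (u n) (ν n) (q * (q ^ n * q ^ n))) ⟩
      ∑< n θ + θ n ∎

  σ : ℕ → Carrier
  σ zero    = 1#
  σ (suc k) = - σ k

  -- The recursion of `e` adds up the exponents of the factors q² (qᵏ)³.
  u≈σq^ : ∀ k → u k ≈ σ k * q ^ e k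
  u≈σq^ zero    = sym (*-identityˡ 1#)
  u≈σq^ (suc k) = begin
    - (u k * (q * q * (q ^ k * q ^ k * q ^ k)))
      ≈⟨ -‿cong (*-congʳ (u≈σq^ k)) ⟩
    - (σ k * q ^ e k * (q * q * (q ^ k * q ^ k * q ^ k)))
      ≈⟨ solve 4 (λ s x q y → :- (s :* x :* (q :* q :* (y :* y :* y)))
           := (:- s) :* (x :* (y :* (y :* (y :* con (+ 1))) :* (q :* (q :* con (+ 1)))))) refl (σ k) (q ^ e k) q (q ^ k) ⟩
    - σ k * (q ^ e k * ((q ^ k) ^ 3 * q ^ 2))
      ≈⟨ *-congˡ (*-congˡ (*-congʳ (trans (^-assocʳ q k 3) (reflexive (cong (q ^_) (ℕ.*-comm k 3)))))) ⟩
    - σ k * (q ^ e k * (q ^ (3 ℕ.* k) * q ^ 2))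
      ≈⟨ *-congˡ (*-congˡ (^-homo-* q (3 ℕ.* k) 2)) ⟨
    - σ k * (q ^ e k * q ^ (3 ℕ.* k ℕ.+ 2))
      ≈⟨ *-congˡ (^-homo-* q (e k) (3 ℕ.* k ℕ.+ 2)) ⟨
    - σ k * q ^ e (suc k) ∎

  σ-odd : ∀ k → σ (1 ℕ.+ 2 ℕ.* k) ≈ - 1#
  σ-odd zero    = refl
  σ-odd (suc k) = trans (reflexive (cong (λ n → - - σ n) (ℕ.+-suc k (k ℕ.+ 0))))
    (trans (-‿involutive (σ (1 ℕ.+ 2 ℕ.* k))) (σ-odd k))

  1^n≈1 : ∀ n → 1# ^ n ≈ 1#
  1^n≈1 zero    = refl
  1^n≈1 (suc n) = trans (*-identityˡ _) (1^n≈1 n)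

  -- The sign is -1 because N is odd, and the power of q disappears because N divides `e N`.
  u-odd : ∀ k → q ^ (1 ℕ.+ 2 ℕ.* k) ≈ 1# → u (1 ℕ.+ 2 ℕ.* k) ≈ - 1#
  u-odd k qᴺ≈1 = begin
    u N                              ≈⟨ u≈σq^ N ⟩
    σ N * q ^ e N                    ≈⟨ *-cong (σ-odd k) (reflexive (cong (q ^_) (e-odd k))) ⟩
    - 1# * q ^ (N ℕ.* (3 ℕ.* k ℕ.+ 2))  ≈⟨ *-congˡ (^-assocʳ q N (3 ℕ.* k ℕ.+ 2)) ⟨
    - 1# * (q ^ N) ^ (3 ℕ.* k ℕ.+ 2)    ≈⟨ *-congˡ (trans (^-congˡ (3 ℕ.* k ℕ.+ 2) qᴺ≈1) (1^n≈1 (3 ℕ.* k ℕ.+ 2))) ⟩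
    - 1# * 1#                        ≈⟨ *-identityʳ _ ⟩
    - 1#                             ∎
    where
    N = 1 ℕ.+ 2 ℕ.* k

  θ-expand : ∀ s k → s * θ k ≈
    σ k * (ν (6 ℕ.* k ℕ.+ 5) * (s * q ^ e₅ k) - ν (6 ℕ.* k ℕ.+ 1) * (s * q ^ e k))
  θ-expand s k = begin
    s * (u k * ((ν 6 * ν k + ν 5) * (q * (q ^ k * q ^ k)) - (ν 6 * ν k + 1#)))
      ≈⟨ *-congˡ (*-cong (sym (u≈σq^ k)) (+-cong
           (*-cong (ν-affine 6 k 5) (*-congˡ (^-homo-* q k k)))
           (-‿cong (trans (ν-affine 6 k 1) (+-congˡ (+-identityʳ 1#)))))) ⟨
    s * (σ k * q ^ e k * (a₅ * q ^ (1 ℕ.+ (k ℕ.+ k)) - a₁))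
      ≈⟨ solve 6 (λ s σ x a y b → s :* (σ :* x :* (a :* y :- b)) := σ :* (a :* (s :* (x :* y)) :- b :* (s :* x)))
           refl s (σ k) (q ^ e k) a₅ (q ^ (1 ℕ.+ (k ℕ.+ k))) a₁ ⟩
    σ k * (a₅ * (s * (q ^ e k * q ^ (1 ℕ.+ (k ℕ.+ k)))) - a₁ * (s * q ^ e k))
      ≈⟨ *-congˡ (+-congʳ (*-congˡ (*-congˡ (^-homo-* q (e k) (1 ℕ.+ (k ℕ.+ k)))))) ⟨
    σ k * (a₅ * (s * q ^ e₅ k) - a₁ * (s * q ^ e k)) ∎
    where
    a₁ = ν (6 ℕ.* k ℕ.+ 1)
    a₅ = ν (6 ℕ.* k ℕ.+ 5)
    ν-affine : ∀ a k b → ν (a ℕ.* k ℕ.+ b) ≈ ν a * ν k + ν b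
    ν-affine a k b = trans (×-homo-+ 1# (a ℕ.* k) b) (+-congʳ (×1-homo-* a k))

  -- By the strange identity the element is a signed sum of members of the two families. In the
  -- application `s` is a power of 1 - X and `G` is divisibility of one coefficient.
  strange-membership : ∀ {g} {G : Carrier → Set g} → IsSubgroup R G →
    ∀ K k s → O 1 (1# - q) → h ^ K ≈ 0# → q ^ (1 ℕ.+ 2 ℕ.* k) ≈ 1# →
    (∀ n → G (ν (6 ℕ.* n ℕ.+ 1) * (s * q ^ e n))) →
    (∀ n → G (ν (6 ℕ.* n ℕ.+ 5) * (s * q ^ e₅ n))) →
    G (ν 4 * (s * ∑< (suc K) ⟨ q ⟩_))
  strange-membership {G = G} subgroup K k s q≡1 hᴷ≈0 qᴺ≈1 g₁ g₅ = resp (begin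
    s * ∑< N θ                        ≈⟨ *-congˡ (strange-identity K N q≡1 hᴷ≈0 qᴺ≈1 (u-odd k qᴺ≈1)) ⟨
    s * (ν 4 * ∑< (suc K) ⟨ q ⟩_)     ≈⟨ solve 3 (λ a b c → a :* (b :* c) := b :* (a :* c)) refl s (ν 4) (∑< (suc K) ⟨ q ⟩_) ⟩
    ν 4 * (s * ∑< (suc K) ⟨ q ⟩_)     ∎) (g-∑ N)
    where
    open IsSubgroup subgroup
    N = 1 ℕ.+ 2 ℕ.* k
    g-σ : ∀ k {x} → G x → G (σ k * x)
    g-σ zero    g = resp (sym (*-identityˡ _)) g
    g-σ (suc k) g = resp (-‿distribˡ-* (σ k) _) (-∈ (g-σ k g))
    g-∑ : ∀ n → G (s * ∑< n θ)
    g-∑ zero    = resp (sym (zeroʳ s)) 0∈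
    g-∑ (suc n) = resp (sym (distribˡ s (∑< n θ) (θ n)))
      (+∈ (g-∑ n) (resp (sym (θ-expand s n)) (g-σ n (+∈ (g₅ n) (-∈ (g₁ n))))))

-- Ideals and quotient rings.

record IsIdeal {c ℓ i} (R : CommutativeRing c ℓ) (I : CommutativeRing.Carrier R → Set i) : Set (c ⊔ ℓ ⊔ i) where
  open CommutativeRing R
  field
    resp : ∀ {x y} → x ≈ y → I x → I y
    0∈   : I 0#
    +∈   : ∀ {x y} → I x → I y → I (x + y)
    *∈   : ∀ {x} y → I x → I (y * x)

module Quotient {c ℓ i} (R : CommutativeRing c ℓ) {I : CommutativeRing.Carrier R → Set i} (ideal : IsIdeal R I) where
  open CommutativeRing R
  open IsIdeal ideal
  open IntegerCoefficients R

  infix 4 _≈ᴵ_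
  -- A record rather than a synonym for `I (x - y)`, so that x and y can be recovered from the type
  -- of a proof.
  record _≈ᴵ_ (x y : Carrier) : Set i where
    constructor congruent
    field difference : I (x - y)

  ≈⇒≈ᴵ : ∀ {x y} → x ≈ y → x ≈ᴵ y
  ≈⇒≈ᴵ {x} {y} x≈y = congruent (resp (sym (trans (+-congʳ x≈y) (-‿inverseʳ y))) 0∈)

  quotientRing : CommutativeRing c i
  quotientRing = record
    { Carrier = Carrier
    ; _≈_ = _≈ᴵ_
    ; _+_ = _+_
    ; _*_ = _*_
    ; -_ = -_
    ; 0# = 0#
    ; 1# = 1#
    ; isCommutativeRing = record
      { isRing = record
        { +-isAbelianGroup = record
          { isGroup = record
            { isMonoid = record
              { isSemigroup = record
                { isMagma = record
                  { isEquivalence = record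
                    { refl = ≈⇒≈ᴵ refl
                    ; sym = λ {x} {y} (congruent p) → congruent (resp
                        (solve 2 (λ x y → (:- con (+ 1)) :* (x :- y) := y :- x) refl x y) (*∈ (- 1#) p))
                    ; trans = λ {x} {y} {z} (congruent p) (congruent q) → congruent (resp
                        (solve 3 (λ x y z → (x :- y) :+ (y :- z) := x :- z) refl x y z) (+∈ p q)) }
                  ; ∙-cong = λ {x} {x′} {y} {y′} (congruent p) (congruent q) → congruent (resp
                      (solve 4 (λ x x′ y y′ → (x :- x′) :+ (y :- y′) := x :+ y :- (x′ :+ y′)) refl x x′ y y′) (+∈ p q)) }
                ; assoc = λ x y z → ≈⇒≈ᴵ (+-assoc x y z) }
              ; identity = (λ x → ≈⇒≈ᴵ (+-identityˡ x)) , (λ x → ≈⇒≈ᴵ (+-identityʳ x)) }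
            ; inverse = (λ x → ≈⇒≈ᴵ (-‿inverseˡ x)) , (λ x → ≈⇒≈ᴵ (-‿inverseʳ x))
            ; ⁻¹-cong = λ {x} {y} (congruent p) → congruent (resp
                (solve 2 (λ x y → (:- con (+ 1)) :* (x :- y) := :- x :- (:- y)) refl x y) (*∈ (- 1#) p)) }
          ; comm = λ x y → ≈⇒≈ᴵ (+-comm x y) }
        ; *-cong = λ {x} {x′} {y} {y′} (congruent p) (congruent q) → congruent (resp
            (solve 4 (λ x x′ y y′ → y :* (x :- x′) :+ x′ :* (y :- y′) := x :* y :- x′ :* y′) refl x x′ y y′)
            (+∈ (*∈ y p) (*∈ x′ q)))
        ; *-assoc = λ x y z → ≈⇒≈ᴵ (*-assoc x y z)
        ; *-identity = (λ x → ≈⇒≈ᴵ (*-identityˡ x)) , (λ x → ≈⇒≈ᴵ (*-identityʳ x))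
        ; distrib = (λ x y z → ≈⇒≈ᴵ (distribˡ x y z)) , (λ x y z → ≈⇒≈ᴵ (distribʳ x y z))
        }
      ; *-comm = λ x y → ≈⇒≈ᴵ (*-comm x y)
      }
    }

open import Data.Integer using (_+_; _-_; _*_; -_)
open import Relation.Binary.PropositionalEquality using (refl; sym; trans; module ≡-Reasoning)

private
  E : ℤ → Series
  E = powOneMinusQ

-- Power series

sumTo-cong : ∀ n {f g} → (∀ i → i ≤ n → f i ≡ g i) → sumTo n f ≡ sumTo n g
sumTo-cong zero    eq = eq 0 z≤n
sumTo-cong (suc n) eq = cong₂ _+_ (sumTo-cong n (λ i i≤n → eq i (ℕ.m≤n⇒m≤1+n i≤n))) (eq (suc n) ℕ.≤-refl)

sumTo-head : ∀ n f → sumTo (suc n) f ≡ f 0 + sumTo n (f ∘ suc)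
sumTo-head zero    f = refl
sumTo-head (suc n) f = trans (cong (_+ f (suc (suc n))) (sumTo-head n f)) (ℤ.+-assoc (f 0) _ _)

-- Peeling off the first summand, or the last one in `⊛-sucʳ`, replaces a factor by its shift. The
-- ring laws follow by induction on the index, for all series at once.
⊛-sucˡ : ∀ f g n → (f ⊛ g) (suc n) ≡ f 0 * g (suc n) + ((f ∘ suc) ⊛ g) n
⊛-sucˡ f g n = sumTo-head n _

⊛-sucʳ : ∀ f g n → (f ⊛ g) (suc n) ≡ (f ⊛ (g ∘ suc)) n + f (suc n) * g 0
⊛-sucʳ f g n = cong₂ _+_
  (sumTo-cong n (λ i i≤n → cong (λ k → f i * g k) (ℕ.+-∸-assoc 1 i≤n)))
  (cong (λ k → f (suc n) * g k) (ℕ.n∸n≡0 n))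

⊛-cong : ∀ {f f′ g g′} → f ≗ f′ → g ≗ g′ → (f ⊛ g) ≗ (f′ ⊛ g′)
⊛-cong p q n = sumTo-cong n (λ i _ → cong₂ _*_ (p i) (q _))

_⊞_ : Series → Series → Series
(f ⊞ g) n = f n + g n

0S : Series
0S _ = + 0

⊛-comm : ∀ f g → (f ⊛ g) ≗ (g ⊛ f)
⊛-comm f g zero    = ℤ.*-comm (f 0) (g 0)
⊛-comm f g (suc n) = begin
  (f ⊛ g) (suc n)                          ≡⟨ ⊛-sucˡ f g n ⟩
  f 0 * g (suc n) + ((f ∘ suc) ⊛ g) n      ≡⟨ cong₂ _+_ (ℤ.*-comm (f 0) _) (⊛-comm (f ∘ suc) g n) ⟩
  g (suc n) * f 0 + (g ⊛ (f ∘ suc)) n      ≡⟨ ℤ.+-comm (g (suc n) * f 0) _ ⟩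
  (g ⊛ (f ∘ suc)) n + g (suc n) * f 0      ≡⟨ ⊛-sucʳ g f n ⟨
  (g ⊛ f) (suc n)                          ∎
  where open ≡-Reasoning

⊛-distribʳ : ∀ h f g → ((f ⊞ g) ⊛ h) ≗ ((f ⊛ h) ⊞ (g ⊛ h))
⊛-distribʳ h f g zero    = ℤ.*-distribʳ-+ (h 0) (f 0) (g 0)
⊛-distribʳ h f g (suc n) = begin
  ((f ⊞ g) ⊛ h) (suc n)
    ≡⟨ ⊛-sucˡ (f ⊞ g) h n ⟩
  (f 0 + g 0) * h (suc n) + (((f ∘ suc) ⊞ (g ∘ suc)) ⊛ h) n
    ≡⟨ cong (_+_ ((f 0 + g 0) * h (suc n))) (⊛-distribʳ h (f ∘ suc) (g ∘ suc) n) ⟩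
  (f 0 + g 0) * h (suc n) + (((f ∘ suc) ⊛ h) n + ((g ∘ suc) ⊛ h) n)
    ≡⟨ rearrange (f 0) (g 0) (h (suc n)) _ _ ⟩
  f 0 * h (suc n) + ((f ∘ suc) ⊛ h) n + (g 0 * h (suc n) + ((g ∘ suc) ⊛ h) n)
    ≡⟨ cong₂ _+_ (⊛-sucˡ f h n) (⊛-sucˡ g h n) ⟨
  (f ⊛ h) (suc n) + (g ⊛ h) (suc n) ∎
  where
  open ≡-Reasoning
  rearrange : ∀ a b c x y → (a + b) * c + (x + y) ≡ a * c + x + (b * c + y)
  rearrange = solve-∀

⊛-scaleˡ : ∀ c f g → ((λ n → c * f n) ⊛ g) ≗ (λ n → c * (f ⊛ g) n)
⊛-scaleˡ c f g zero    = ℤ.*-assoc c (f 0) (g 0)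
⊛-scaleˡ c f g (suc n) = begin
  ((λ n → c * f n) ⊛ g) (suc n)
    ≡⟨ ⊛-sucˡ (λ n → c * f n) g n ⟩
  c * f 0 * g (suc n) + ((λ n → c * f (suc n)) ⊛ g) n
    ≡⟨ cong (_+_ (c * f 0 * g (suc n))) (⊛-scaleˡ c (f ∘ suc) g n) ⟩
  c * f 0 * g (suc n) + c * ((f ∘ suc) ⊛ g) n
    ≡⟨ factor c (f 0) (g (suc n)) _ ⟩
  c * (f 0 * g (suc n) + ((f ∘ suc) ⊛ g) n)
    ≡⟨ cong (c *_) (⊛-sucˡ f g n) ⟨
  c * (f ⊛ g) (suc n) ∎
  where
  open ≡-Reasoning
  factor : ∀ c a b x → c * a * b + c * x ≡ c * (a * b + x)
  factor = solve-∀

⊛-assoc : ∀ f g h → ((f ⊛ g) ⊛ h) ≗ (f ⊛ (g ⊛ h))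
⊛-assoc f g h zero    = ℤ.*-assoc (f 0) (g 0) (h 0)
⊛-assoc f g h (suc n) = begin
  ((f ⊛ g) ⊛ h) (suc n)
    ≡⟨ ⊛-sucˡ (f ⊛ g) h n ⟩
  f 0 * g 0 * h (suc n) + (((f ⊛ g) ∘ suc) ⊛ h) n
    ≡⟨ cong (_+_ (f 0 * g 0 * h (suc n))) (⊛-cong {g = h} (⊛-sucˡ f g) (λ _ → refl) n) ⟩
  f 0 * g 0 * h (suc n) + (((λ k → f 0 * g (suc k)) ⊞ ((f ∘ suc) ⊛ g)) ⊛ h) n
    ≡⟨ cong (_+_ (f 0 * g 0 * h (suc n))) (⊛-distribʳ h (λ k → f 0 * g (suc k)) ((f ∘ suc) ⊛ g) n) ⟩
  f 0 * g 0 * h (suc n) + (((λ k → f 0 * g (suc k)) ⊛ h) n + (((f ∘ suc) ⊛ g) ⊛ h) n)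
    ≡⟨ cong (_+_ (f 0 * g 0 * h (suc n))) (cong₂ _+_ (⊛-scaleˡ (f 0) (g ∘ suc) h n) (⊛-assoc (f ∘ suc) g h n)) ⟩
  f 0 * g 0 * h (suc n) + (f 0 * ((g ∘ suc) ⊛ h) n + ((f ∘ suc) ⊛ (g ⊛ h)) n)
    ≡⟨ rearrange (f 0) (g 0) (h (suc n)) _ _ ⟩
  f 0 * (g 0 * h (suc n) + ((g ∘ suc) ⊛ h) n) + ((f ∘ suc) ⊛ (g ⊛ h)) n
    ≡⟨ cong (λ x → f 0 * x + ((f ∘ suc) ⊛ (g ⊛ h)) n) (⊛-sucˡ g h n) ⟨
  f 0 * (g ⊛ h) (suc n) + ((f ∘ suc) ⊛ (g ⊛ h)) n
    ≡⟨ ⊛-sucˡ f (g ⊛ h) n ⟨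
  (f ⊛ (g ⊛ h)) (suc n) ∎
  where
  open ≡-Reasoning
  rearrange : ∀ a b c x y → a * b * c + (a * x + y) ≡ a * (b * c + x) + y
  rearrange = solve-∀

⊛-zeroˡ : ∀ f → (0S ⊛ f) ≗ 0S
⊛-zeroˡ f zero    = refl
⊛-zeroˡ f (suc n) = trans (⊛-sucˡ 0S f n) (trans (ℤ.+-identityˡ _) (⊛-zeroˡ f n))

⊛-identityˡ : ∀ f → (oneS ⊛ f) ≗ f
⊛-identityˡ f zero    = ℤ.*-identityˡ (f 0)
⊛-identityˡ f (suc n) = trans (⊛-sucˡ oneS f n)
  (trans (cong₂ _+_ (ℤ.*-identityˡ (f (suc n))) (⊛-zeroˡ f n)) (ℤ.+-identityʳ _))

powerSeries : CommutativeRing 0ℓ 0ℓ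
powerSeries = record
  { Carrier = Series
  ; _≈_ = _≗_
  ; _+_ = _⊞_
  ; _*_ = _⊛_
  ; -_ = λ f n → - f n
  ; 0# = 0S
  ; 1# = oneS
  ; isCommutativeRing = record
    { isRing = record
      { +-isAbelianGroup = record
        { isGroup = record
          { isMonoid = record
            { isSemigroup = record
              { isMagma = record
                { isEquivalence = record
                  { refl = λ _ → refl ; sym = λ p n → sym (p n) ; trans = λ p q n → trans (p n) (q n) }
                ; ∙-cong = λ p q n → cong₂ _+_ (p n) (q n) }
              ; assoc = λ f g h n → ℤ.+-assoc (f n) (g n) (h n) }
            ; identity = (λ f n → ℤ.+-identityˡ (f n)) , (λ f n → ℤ.+-identityʳ (f n)) }
          ; inverse = (λ f n → ℤ.+-inverseˡ (f n)) , (λ f n → ℤ.+-inverseʳ (f n))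
          ; ⁻¹-cong = λ p n → cong -_ (p n) }
        ; comm = λ f g n → ℤ.+-comm (f n) (g n) }
      ; *-cong = ⊛-cong
      ; *-assoc = ⊛-assoc
      ; *-identity = ⊛-identityˡ , (λ f n → trans (⊛-comm f oneS n) (⊛-identityˡ f n))
      ; distrib =
          (λ h f g n → trans (⊛-comm h (f ⊞ g) n)
            (trans (⊛-distribʳ h f g n) (cong₂ _+_ (⊛-comm f h n) (⊛-comm g h n)))) ,
          ⊛-distribʳ
      }
    ; *-comm = ⊛-comm
    }
  }

∣-sumTo : ∀ {m} n {f} → (∀ i → i ≤ n → m ∣ˢ f i) → m ∣ˢ sumTo n f
∣-sumTo zero    p = p 0 z≤n
∣-sumTo (suc n) p = ∣.∣m∣n⇒∣m+n (∣-sumTo n (λ i i≤n → p i (ℕ.m≤n⇒m≤1+n i≤n))) (p (suc n) ℕ.≤-refl)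

-- Membership in the ideal generated by m and the power X ^ (D + 1).
DivisibleUpTo : ℤ → ℕ → Series → Set
DivisibleUpTo m D f = ∀ n → n ≤ D → m ∣ˢ f n

divisibleUpTo-isIdeal : ∀ m D → IsIdeal powerSeries (DivisibleUpTo m D)
divisibleUpTo-isIdeal m D = record
  { resp  = λ eq p n n≤D → subst (m ∣ˢ_) (eq n) (p n n≤D)
  ; 0∈    = λ n _ → ∣.divides (+ 0) refl
  ; +∈    = λ p q n n≤D → ∣.∣m∣n⇒∣m+n (p n n≤D) (q n n≤D)
  ; *∈    = λ y p n n≤D → ∣-sumTo n (λ i _ → ∣.∣n⇒∣m*n (y i) (p _ (ℕ.≤-trans (ℕ.m∸n≤m n i) n≤D)))
  }

-- Multiplication by 1 - X, and the binomial series (1 - X)^a for integers a.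

∇ : Series → Series
∇ f zero    = f 0
∇ f (suc n) = f (suc n) - f n

∇-cong : ∀ {f g} → f ≗ g → ∇ f ≗ ∇ g
∇-cong p zero    = p 0
∇-cong p (suc n) = cong₂ _-_ (p (suc n)) (p n)

-- A series is the sequence of partial sums of its differences. This permits the passage from
-- exponent a + 1 back to a.
∇-injective : ∀ {f g} → ∇ f ≗ ∇ g → f ≗ g
∇-injective p zero = p 0
∇-injective {f} {g} p (suc n) = begin
  f (suc n)              ≡⟨ add-back (f (suc n)) (f n) ⟨
  f (suc n) - f n + f n  ≡⟨ cong₂ _+_ (p (suc n)) (∇-injective p n) ⟩
  g (suc n) - g n + g n  ≡⟨ add-back (g (suc n)) (g n) ⟩
  g (suc n)              ∎
  where
  open ≡-Reasoning
  add-back : ∀ a b → a - b + b ≡ a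
  add-back = solve-∀

∇-⊛ : ∀ f g → (∇ f ⊛ g) ≗ ∇ (f ⊛ g)
∇-⊛ f g zero    = refl
∇-⊛ f g (suc n) = begin
  (∇ f ⊛ g) (suc n)
    ≡⟨ ⊛-sucˡ (∇ f) g n ⟩
  f 0 * g (suc n) + (((f ∘ suc) ⊞ (λ k → - f k)) ⊛ g) n
    ≡⟨ cong (_+_ (f 0 * g (suc n))) (trans (⊛-distribʳ g (f ∘ suc) (λ k → - f k) n)
         (cong (_+_ (((f ∘ suc) ⊛ g) n)) (trans (⊛-cong {g = g} (λ k → sym (ℤ.-1*i≡-i (f k))) (λ _ → refl) n)
           (⊛-scaleˡ (- + 1) f g n)))) ⟩
  f 0 * g (suc n) + (((f ∘ suc) ⊛ g) n + - + 1 * (f ⊛ g) n)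
    ≡⟨ rearrange (f 0 * g (suc n)) _ _ ⟩
  f 0 * g (suc n) + ((f ∘ suc) ⊛ g) n - (f ⊛ g) n
    ≡⟨ cong (_- (f ⊛ g) n) (⊛-sucˡ f g n) ⟨
  (f ⊛ g) (suc n) - (f ⊛ g) n ∎
  where
  open ≡-Reasoning
  rearrange : ∀ a b c → a + (b + - + 1 * c) ≡ a + b - c
  rearrange = solve-∀

-- Induction in both directions from 0. It avoids the case split on signs in the definition of the
-- binomial series, since `E-suc` has one form for all exponents.
ℤ-induction : ∀ {ℓ} (P : ℤ → Set ℓ) → P (+ 0) →
  (∀ a → P a → P (+ 1 + a)) → (∀ a → P (+ 1 + a) → P a) → ∀ a → P a
ℤ-induction P p₀ up down (+ zero)       = p₀
ℤ-induction P p₀ up down (+ suc n)      = up (+ n) (ℤ-induction P p₀ up down (+ n))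
ℤ-induction P p₀ up down -[1+ zero ]    = down -[1+ 0 ] p₀
ℤ-induction P p₀ up down -[1+ (suc n) ] = down -[1+ (suc n) ] (ℤ-induction P p₀ up down -[1+ n ])

E-0 : E (+ 0) ≗ oneS
E-0 zero    = refl
E-0 (suc n) = ℤ.*-zeroʳ (neg1^ (suc n))

E-head : ∀ a → E a 0 ≡ + 1
E-head (+ n)    = refl
E-head -[1+ n ] = refl

-- Pascal's rule in either range of signs. In between, at a = -1, all coefficients of 1/(1 - X) are
-- 1 and their differences vanish.
E-suc : ∀ a → E (+ 1 + a) ≗ ∇ (E a)
E-suc a zero = trans (E-head (+ 1 + a)) (sym (E-head a))
E-suc (+ a) (suc n) = begin
  - neg1^ n * + (suc a C suc n)
    ≡⟨ cong (λ k → - neg1^ n * + k) (nCk+nC[k+1]≡[n+1]C[k+1] a n) ⟨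
  - neg1^ n * (+ (a C n) + + (a C suc n))
    ≡⟨ expand (neg1^ n) (+ (a C n)) (+ (a C suc n)) ⟩
  - neg1^ n * + (a C suc n) - neg1^ n * + (a C n) ∎
  where
  open ≡-Reasoning
  expand : ∀ s x y → - s * (x + y) ≡ - s * y - s * x
  expand = solve-∀
E-suc -[1+ zero ] (suc n) = begin
  E (+ 0) (suc n)                    ≡⟨ E-0 (suc n) ⟩
  + 0                                ≡⟨ cong₂ (λ x y → + x - + y) (nCn≡1 (suc n)) (nCn≡1 n) ⟨
  + (suc n C suc n) - + (n C n)      ∎
  where open ≡-Reasoning
E-suc -[1+ suc b ] (suc n) = begin
  + (N C suc n)                              ≡⟨ cancel (+ (N C n)) (+ (N C suc n)) ⟨
  + (N C n) + + (N C suc n) - + (N C n)      ≡⟨ cong (λ k → + k - + (N C n)) (nCk+nC[k+1]≡[n+1]C[k+1] N n) ⟩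
  + (suc N C suc n) - + (N C n)              ≡⟨ cong (λ k → + (suc N C suc n) - + (k C n)) (ℕ.+-suc b n) ⟩
  + (suc N C suc n) - + ((suc b ℕ.+ n) C n)  ∎
  where
  open ≡-Reasoning
  N : ℕ
  N = b ℕ.+ suc n
  cancel : ∀ x y → x + y - x ≡ y
  cancel = solve-∀

E-+ : ∀ a b → E (a + b) ≗ (E a ⊛ E b)
E-+ = ℤ-induction (λ a → ∀ b → E (a + b) ≗ (E a ⊛ E b))
  (λ b n → begin
    E (+ 0 + b) n      ≡⟨ cong (λ c → E c n) (ℤ.+-identityˡ b) ⟩
    E b n              ≡⟨ ⊛-identityˡ (E b) n ⟨
    (oneS ⊛ E b) n     ≡⟨ ⊛-cong {g = E b} E-0 (λ _ → refl) n ⟨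
    (E (+ 0) ⊛ E b) n  ∎)
  (λ a hom b n → begin
    E (+ 1 + a + b) n       ≡⟨ step a b n ⟩
    ∇ (E (a + b)) n         ≡⟨ ∇-cong (hom b) n ⟩
    ∇ (E a ⊛ E b) n         ≡⟨ right a b n ⟨
    (E (+ 1 + a) ⊛ E b) n   ∎)
  (λ a hom b → ∇-injective (λ n → begin
    ∇ (E (a + b)) n         ≡⟨ step a b n ⟨
    E (+ 1 + a + b) n       ≡⟨ hom b n ⟩
    (E (+ 1 + a) ⊛ E b) n   ≡⟨ right a b n ⟩
    ∇ (E a ⊛ E b) n         ∎))
  where
  open ≡-Reasoning
  step : ∀ a b n → E (+ 1 + a + b) n ≡ ∇ (E (a + b)) n
  step a b n = trans (cong (λ c → E c n) (ℤ.+-assoc (+ 1) a b)) (E-suc (a + b) n)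
  right : ∀ a b n → (E (+ 1 + a) ⊛ E b) n ≡ ∇ (E a ⊛ E b) n
  right a b n = trans (⊛-cong {g = E b} (E-suc a) (λ _ → refl) n) (∇-⊛ (E a) (E b) n)

-- The coefficients of the differential equation (1 - X) f′ = - a f. The step towards smaller a also
-- uses the claim at the preceding index.
E-recurrence : ∀ a n → + suc n * E a (suc n) ≡ (+ n - a) * E a n
E-recurrence = ℤ-induction _ base up down
  where
  open ≡-Reasoning
  base : ∀ n → + suc n * E (+ 0) (suc n) ≡ (+ n - + 0) * E (+ 0) n
  base n = trans (cong (+ suc n *_) (E-0 (suc n)))
    (trans (ℤ.*-zeroʳ (+ suc n)) (sym (trans (cong ((+ n - + 0) *_) (E-0 n)) (vanish n))))
    where
    vanish : ∀ n → (+ n - + 0) * oneS n ≡ + 0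
    vanish zero    = refl
    vanish (suc n) = ℤ.*-zeroʳ (+ suc n - + 0)
  up : ∀ a → (∀ n → + suc n * E a (suc n) ≡ (+ n - a) * E a n) →
    ∀ n → + suc n * E (+ 1 + a) (suc n) ≡ (+ n - (+ 1 + a)) * E (+ 1 + a) n
  up a rec zero = begin
    + 1 * E (+ 1 + a) 1               ≡⟨ cong (+ 1 *_) (E-suc a 1) ⟩
    + 1 * (E a 1 - E a 0)             ≡⟨ ℤ.*-distribˡ-+ (+ 1) (E a 1) (- E a 0) ⟩
    + 1 * E a 1 + + 1 * - E a 0       ≡⟨ cong (_+ + 1 * - E a 0) (rec 0) ⟩
    (+ 0 - a) * E a 0 + + 1 * - E a 0 ≡⟨ collect a (E a 0) ⟩
    (+ 0 - (+ 1 + a)) * E a 0         ≡⟨ cong ((+ 0 - (+ 1 + a)) *_) (E-suc a 0) ⟨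
    (+ 0 - (+ 1 + a)) * E (+ 1 + a) 0 ∎
    where
    collect : ∀ a x → (+ 0 - a) * x + + 1 * - x ≡ (+ 0 - (+ 1 + a)) * x
    collect = solve-∀
  up a rec (suc n) = begin
    + (2 ℕ.+ n) * E (+ 1 + a) (2 ℕ.+ n)
      ≡⟨ cong (+ (2 ℕ.+ n) *_) (E-suc a (2 ℕ.+ n)) ⟩
    + (2 ℕ.+ n) * (E a (2 ℕ.+ n) - E a (suc n))
      ≡⟨ ℤ.*-distribˡ-+ (+ (2 ℕ.+ n)) (E a (2 ℕ.+ n)) (- E a (suc n)) ⟩
    + (2 ℕ.+ n) * E a (2 ℕ.+ n) + + (2 ℕ.+ n) * - E a (suc n)
      ≡⟨ cong (_+ + (2 ℕ.+ n) * - E a (suc n)) (rec (suc n)) ⟩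
    (+ suc n - a) * E a (suc n) + + (2 ℕ.+ n) * - E a (suc n)
      ≡⟨ collect (+ n) a (E a (suc n)) ⟩
    (+ n - a) * E a (suc n) - + suc n * E a (suc n)
      ≡⟨ cong (λ x → (+ n - a) * E a (suc n) - x) (rec n) ⟩
    (+ n - a) * E a (suc n) - (+ n - a) * E a n
      ≡⟨ collect′ (+ n) a (E a (suc n)) (E a n) ⟩
    (+ suc n - (+ 1 + a)) * (E a (suc n) - E a n)
      ≡⟨ cong ((+ suc n - (+ 1 + a)) *_) (E-suc a (suc n)) ⟨
    (+ suc n - (+ 1 + a)) * E (+ 1 + a) (suc n) ∎
    where
    collect : ∀ n a x → (+ 1 + n - a) * x + (+ 2 + n) * - x ≡ (n - a) * x - (+ 1 + n) * x
    collect = solve-∀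
    collect′ : ∀ n a x y → (n - a) * x - (n - a) * y ≡ (+ 1 + n - (+ 1 + a)) * (x - y)
    collect′ = solve-∀
  down : ∀ a → (∀ n → + suc n * E (+ 1 + a) (suc n) ≡ (+ n - (+ 1 + a)) * E (+ 1 + a) n) →
    ∀ n → + suc n * E a (suc n) ≡ (+ n - a) * E a n
  down a rec zero = begin
    + 1 * E a 1                                   ≡⟨ split (E a 1) (E a 0) ⟩
    + 1 * (E a 1 - E a 0) + E a 0                 ≡⟨ cong (λ x → + 1 * x + E a 0) (E-suc a 1) ⟨
    + 1 * E (+ 1 + a) 1 + E a 0                   ≡⟨ cong (_+ E a 0) (rec 0) ⟩
    (+ 0 - (+ 1 + a)) * E (+ 1 + a) 0 + E a 0     ≡⟨ cong (λ x → (+ 0 - (+ 1 + a)) * x + E a 0) (E-suc a 0) ⟩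
    (+ 0 - (+ 1 + a)) * E a 0 + E a 0             ≡⟨ collect a (E a 0) ⟩
    (+ 0 - a) * E a 0                             ∎
    where
    split : ∀ x y → + 1 * x ≡ + 1 * (x - y) + y
    split = solve-∀
    collect : ∀ a x → (+ 0 - (+ 1 + a)) * x + x ≡ (+ 0 - a) * x
    collect = solve-∀
  down a rec (suc n) = begin
    + (2 ℕ.+ n) * E a (2 ℕ.+ n)
      ≡⟨ split (+ n) (E a (2 ℕ.+ n)) (E a (suc n)) ⟩
    + (2 ℕ.+ n) * (E a (2 ℕ.+ n) - E a (suc n)) + + (2 ℕ.+ n) * E a (suc n)
      ≡⟨ cong (λ x → + (2 ℕ.+ n) * x + + (2 ℕ.+ n) * E a (suc n)) (E-suc a (2 ℕ.+ n)) ⟨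
    + (2 ℕ.+ n) * E (+ 1 + a) (2 ℕ.+ n) + + (2 ℕ.+ n) * E a (suc n)
      ≡⟨ cong (_+ + (2 ℕ.+ n) * E a (suc n)) (rec (suc n)) ⟩
    (+ suc n - (+ 1 + a)) * E (+ 1 + a) (suc n) + + (2 ℕ.+ n) * E a (suc n)
      ≡⟨ cong (λ x → (+ suc n - (+ 1 + a)) * x + + (2 ℕ.+ n) * E a (suc n)) (E-suc a (suc n)) ⟩
    (+ suc n - (+ 1 + a)) * (E a (suc n) - E a n) + + (2 ℕ.+ n) * E a (suc n)
      ≡⟨ collect (+ n) a (E a (suc n)) (E a n) ⟩
    (+ suc n - a + + suc n) * E a (suc n) - (+ n - a) * E a n
      ≡⟨ cong (λ x → (+ suc n - a + + suc n) * E a (suc n) - x) (down a rec n) ⟨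
    (+ suc n - a + + suc n) * E a (suc n) - + suc n * E a (suc n)
      ≡⟨ collect′ (+ suc n) a (E a (suc n)) ⟩
    (+ suc n - a) * E a (suc n) ∎
    where
    split : ∀ n x y → (+ 2 + n) * x ≡ (+ 2 + n) * (x - y) + (+ 2 + n) * y
    split = solve-∀
    collect : ∀ n a x y → (+ 1 + n - (+ 1 + a)) * (x - y) + (+ 2 + n) * x ≡ (+ 1 + n - a + (+ 1 + n)) * x - (n - a) * y
    collect = solve-∀
    collect′ : ∀ n a x → (n - a + n) * x - n * x ≡ (n - a) * x
    collect′ = solve-∀

-- The derivative of (1 - X)^(a+1), which exhibits the exponent as a factor of the coefficients.
E-absorption : ∀ a n → + suc n * E (+ 1 + a) (suc n) ≡ - (+ 1 + a) * E a n
E-absorption a n = begin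
  + suc n * E (+ 1 + a) (suc n)                ≡⟨ cong (+ suc n *_) (E-suc a (suc n)) ⟩
  + suc n * (E a (suc n) - E a n)              ≡⟨ ℤ.*-distribˡ-+ (+ suc n) (E a (suc n)) (- E a n) ⟩
  + suc n * E a (suc n) + + suc n * - E a n    ≡⟨ cong (_+ + suc n * - E a n) (E-recurrence a n) ⟩
  (+ n - a) * E a n + + suc n * - E a n        ≡⟨ collect (+ n) a (E a n) ⟩
  - (+ 1 + a) * E a n                          ∎
  where
  open ≡-Reasoning
  collect : ∀ n a x → (n - a) * x + (+ 1 + n) * - x ≡ - (+ 1 + a) * x
  collect = solve-∀

X : Series
X (suc zero) = + 1
X _          = + 0

X-⊛-suc : ∀ f n → (X ⊛ f) (suc n) ≡ f n
X-⊛-suc f n = trans (⊛-sucˡ X f n) (trans (ℤ.+-identityˡ _)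
  (trans (⊛-cong {g = f} tail-X (λ _ → refl) n) (⊛-identityˡ f n)))
  where
  tail-X : (X ∘ suc) ≗ oneS
  tail-X zero    = refl
  tail-X (suc n) = refl

∣-resp-≡-mod : ∀ {m x y} → m ∣ˢ x - y → m ∣ˢ x → m ∣ˢ y
∣-resp-≡-mod {m} {x} {y} p q = subst (m ∣ˢ_) (cancel x y) (∣.∣m∣n⇒∣m-n q p)
  where
  cancel : ∀ x y → x - (x - y) ≡ y
  cancel = solve-∀

-- ℤ[[X]] / (m, X ^ (D + 1)) with q = (1 - X) ^ r
module Modulo (m : ℤ) (D : ℕ) (r : ℤ) where
  open Quotient powerSeries (divisibleUpTo-isIdeal m D) using (quotientRing; ≈⇒≈ᴵ; congruent) public
  open CommutativeRing quotientRing
    renaming (_+_ to infixl 6 _⊕_; _*_ to infixl 7 _⊗_; _-_ to infixl 6 _⊝_; -_ to infix 8 ~_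
      ; refl to ≈-refl; sym to ≈-sym; trans to ≈-trans)
  open import Algebra.Properties.Semiring.Exp semiring using (_^_)
  open import Relation.Binary.Reasoning.Setoid setoid

  private
    q : Series
    q = E r

  open Pochhammer quotientRing q
  open PowersOf quotientRing X
  open Strange quotientRing q X using (ν; strange-membership)

  coefficient : ∀ {f g} → f ≈ g → ∀ {n} → n ≤ D → m ∣ˢ f n - g n
  coefficient (congruent p) {n} n≤D = p n n≤D

  E-+′ : ∀ a b → E a ⊗ E b ≈ E (a + b)
  E-+′ a b = ≈⇒≈ᴵ (λ n → sym (E-+ a b n))

  E-cong : ∀ {a b} → a ≡ b → E a ≈ E b
  E-cong a≡b = reflexive (cong E a≡b)

  q^≈E : ∀ n → q ^ n ≈ E (r * + n)
  q^≈E zero    = ≈-sym (≈-trans (E-cong (ℤ.*-zeroʳ r)) (≈⇒≈ᴵ E-0))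
  q^≈E (suc n) = begin
    q ⊗ (q ^ n)           ≈⟨ *-congˡ {q} (q^≈E n) ⟩
    q ⊗ E (r * + n)       ≈⟨ E-+′ r (r * + n) ⟩
    E (r + r * + n)       ≈⟨ E-cong (ℤ.*-suc r (+ n)) ⟨
    E (r * + suc n)       ∎

  E-⊛-q^ : ∀ s n → E s ⊗ (q ^ n) ≈ E (s + r * + n)
  E-⊛-q^ s n = ≈-trans (*-congˡ {E s} (q^≈E n)) (E-+′ s (r * + n))

  -- The constant term of 1 - q is 0, so the shifted series is the quotient by X.
  q≡1 : O 1 (oneS ⊖ q)
  q≡1 = multiple ((oneS ⊖ q) ∘ suc) (≈⇒≈ᴵ λ
    { zero    → trans (cong (λ x → + 1 - x) (E-head r)) (sym (⊛-assoc X oneS ((oneS ⊖ q) ∘ suc) 0))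
    ; (suc n) → sym (trans (⊛-assoc X oneS ((oneS ⊖ q) ∘ suc) (suc n))
        (trans (X-⊛-suc (oneS ⊛ ((oneS ⊖ q) ∘ suc)) n) (⊛-identityˡ ((oneS ⊖ q) ∘ suc) n))) })

  X^⊛ : ∀ k f n → n ℕ.< k → ((X ^ k) ⊗ f) n ≡ + 0
  X^⊛ (suc k) f zero    _         = refl
  X^⊛ (suc k) f (suc n) (s≤s n<k) = trans (⊛-assoc X (X ^ k) f (suc n))
    (trans (X-⊛-suc ((X ^ k) ⊗ f) n) (X^⊛ k f n n<k))

  O⇒∣ : ∀ {k f n} → O k f → n ℕ.< k → n ≤ D → m ∣ˢ f n
  O⇒∣ {k} {f} {n} (multiple a p) n<k n≤D = subst (m ∣ˢ_) (ℤ.+-identityʳ (f n))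
    (subst (λ x → m ∣ˢ f n - x) (X^⊛ k a n n<k) (coefficient p n≤D))

  X^suc-D≈0 : X ^ suc D ≈ 0#
  X^suc-D≈0 = congruent λ n n≤D → subst (m ∣ˢ_) (sym (trans (ℤ.+-identityʳ _)
    (trans (sym (⊛-identityʳ (X ^ suc D) n)) (X^⊛ (suc D) oneS n (s≤s n≤D))))) (∣.divides (+ 0) refl)
    where
    ⊛-identityʳ : ∀ f → (f ⊗ oneS) ≗ f
    ⊛-identityʳ = proj₂ (CommutativeRing.*-identity powerSeries)

  ⟨q⟩≈prodT : ∀ n → ⟨ q ⟩ n ≈ prodT r n
  ⟨q⟩≈prodT zero    = ≈-refl
  ⟨q⟩≈prodT (suc n) = *-cong (⟨q⟩≈prodT n) (+-congˡ {oneS} (-‿cong (q^≈E (suc n))))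

  ∑<-coefficient : ∀ n f d → ∑< (suc n) f d ≡ sumTo n (λ k → f k d)
  ∑<-coefficient zero    f d = ℤ.+-identityˡ _
  ∑<-coefficient (suc n) f d = cong (_+ f (suc n) d) (∑<-coefficient n f d)

  sumTo-truncate : ∀ {f d} → (∀ k → d ℕ.< k → m ∣ˢ f k) → ∀ {n} → d ≤ n → m ∣ˢ sumTo n f - sumTo d f
  sumTo-truncate {f} {zero}  p {zero} _ = ∣.divides (+ 0) (ℤ.+-inverseʳ (f 0))
  sumTo-truncate {f} {d} p {suc n} d≤1+n with d ℕ.≟ suc n
  ... | yes refl = ∣.divides (+ 0) (ℤ.+-inverseʳ (sumTo (suc n) f))
  ... | no d≢1+n = subst (m ∣ˢ_) (swap (sumTo n f) (sumTo d f) (f (suc n)))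
          (∣.∣m∣n⇒∣m+n (sumTo-truncate p (ℕ.s≤s⁻¹ d<1+n)) (p (suc n) d<1+n))
    where
    d<1+n = ℕ.≤∧≢⇒< d≤1+n d≢1+n
    swap : ∀ a b c → a - b + c ≡ a + c - b
    swap = solve-∀

  -- The sum defining `sumT` stops at k = d, the one on the left has a common length for all d; the
  -- surplus products are multiples of Xᵏ with k > d. The length is the `suc K` of the strange
  -- identity with K = D + 1, the exponent at which X becomes nilpotent.
  ∑⟨q⟩≈sumT : ∑< (2 ℕ.+ D) ⟨ q ⟩_ ≈ sumT r
  ∑⟨q⟩≈sumT = ≈-trans (∑<-cong (2 ℕ.+ D) ⟨q⟩≈prodT) (congruent λ d d≤D →
    subst (λ x → m ∣ˢ x - sumT r d) (sym (∑<-coefficient (suc D) (prodT r) d))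
      (sumTo-truncate (λ k d<k → O⇒∣ (O-resp-≈ (⟨q⟩≈prodT k) (O-⟨q⟩ q q≡1 k)) d<k d≤D) (ℕ.m≤n⇒m≤1+n d≤D)))

  ν-⊛ : ∀ n f d → (ν n ⊗ f) d ≡ + n * f d
  ν-⊛ zero    f d = ⊛-zeroˡ f d
  ν-⊛ (suc n) f d = trans (⊛-distribʳ f oneS (ν n) d)
    (trans (cong₂ _+_ (⊛-identityˡ f d) (ν-⊛ n f d)) (sym (ℤ.suc-* (+ n) (f d))))

  coefficient-subgroup : IsSubgroup quotientRing (λ f → m ∣ˢ f D)
  coefficient-subgroup = record
    { resp = λ {f} {g} f≈g → ∣-resp-≡-mod (coefficient {f} {g} f≈g ℕ.≤-refl)
    ; 0∈ = ∣.divides (+ 0) refl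
    ; +∈ = ∣.∣m∣n⇒∣m+n
    ; -∈ = ∣.∣m⇒∣-m
    }

  ξ-divisible : ∀ s k → E (r * + (1 ℕ.+ 2 ℕ.* k)) ≈ oneS →
    (∀ n → m ∣ˢ + (6 ℕ.* n ℕ.+ 1) * E (s + r * + e n) D) →
    (∀ n → m ∣ˢ + (6 ℕ.* n ℕ.+ 5) * E (s + r * + e₅ n) D) →
    m ∣ˢ + 4 * ξ r s D
  ξ-divisible s k period div₁ div₅ = subst (m ∣ˢ_) (ν-⊛ 4 (ξ r s) D)
    (resp (*-congˡ {ν 4} (*-congˡ {E s} ∑⟨q⟩≈sumT))
      (strange-membership coefficient-subgroup (suc D) k (E s) q≡1 X^suc-D≈0 (≈-trans (q^≈E (1 ℕ.+ 2 ℕ.* k)) period)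
        (λ n → term (6 ℕ.* n ℕ.+ 1) (e n) (div₁ n))
        (λ n → term (6 ℕ.* n ℕ.+ 5) (e₅ n) (div₅ n))))
    where
    open IsSubgroup coefficient-subgroup
    term : ∀ a n → m ∣ˢ + a * E (s + r * + n) D → m ∣ˢ (ν a ⊗ (E s ⊗ q ^ n)) D
    term a n div = resp {ν a ⊗ E (s + r * + n)} (*-congˡ {ν a} (≈-sym (E-⊛-q^ s n)))
      (subst (m ∣ˢ_) (sym (ν-⊛ a (E (s + r * + n)) D)) div)

-- Divisibility by powers of a prime

∣ˢ-respʳ-≡ : ∀ {m x y} → m ∣ˢ x → x ≡ y → m ∣ˢ y
∣ˢ-respʳ-≡ {m} p eq = subst (m ∣ˢ_) eq p

module PrimeDivisibility {p : ℕ} (p-prime : Prime p) where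
  instance
    p-nonZero : ℕ.NonZero p
    p-nonZero = prime⇒nonZero p-prime

  euclid : ∀ x y → + p ∣ˢ x * y → (+ p ∣ˢ x) ⊎ (+ p ∣ˢ y)
  euclid x y div with euclidsLemma ℤ.∣ x ∣ ℤ.∣ y ∣ p-prime (subst (p ℕ.∣_) (ℤ.abs-* x y) (∣.∣⇒∣ᵤ div))
  ... | inj₁ q = inj₁ (∣.∣ᵤ⇒∣ q)
  ... | inj₂ q = inj₂ (∣.∣ᵤ⇒∣ q)

  p^suc : ∀ l → + (p ℕ.^ suc l) ≡ + p * + (p ℕ.^ l)
  p^suc l = ℤ.pos-* p (p ℕ.^ l)

  -- Euclid's lemma finds a factor p in y; cancelling it on both sides lowers the exponent by one.
  cancel-unit : ∀ l {x y} → ¬ (+ p ∣ˢ x) → + (p ℕ.^ l) ∣ˢ x * y → + (p ℕ.^ l) ∣ˢ y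
  cancel-unit zero    {x} {y} p∤x div = ∣.divides y (sym (ℤ.*-identityʳ y))
  cancel-unit (suc l) {x} {y} p∤x div with euclid x y (∣.∣-trans (∣.∣ᵤ⇒∣ (ℕ.m∣m*n (p ℕ.^ l))) div)
  ... | inj₁ p∣x = ⊥-elim (p∤x p∣x)
  ... | inj₂ (∣.divides y′ refl) = ∣.∣-trans (∣.∣-reflexive (p^suc l))
          (∣ˢ-respʳ-≡ (∣.*-monoʳ-∣ (+ p) (cancel-unit l p∤x
            (∣.*-cancelˡ-∣ (+ p) (subst (_∣ˢ + p * (x * y′)) (p^suc l) (∣ˢ-respʳ-≡ div (move x y′ (+ p)))))))
            (ℤ.*-comm (+ p) y′))
    where
    move : ∀ x y p → x * (y * p) ≡ p * (x * y)
    move = solve-∀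

  -- If x has a factor p, it has just one: the cofactor is prime to p and cancels, while the factor
  -- itself moves over to y.
  cancel-one : ∀ l {x y} → ¬ (+ (p ℕ.* p) ∣ˢ x) → + (p ℕ.^ l) ∣ˢ x * y → + (p ℕ.^ l) ∣ˢ + p * y
  cancel-one l {x} {y} p²∤x div with + p ∣.∣? x
  ... | no p∤x = ∣.∣n⇒∣m*n (+ p) (cancel-unit l p∤x div)
  ... | yes (∣.divides x′ refl) = cancel-unit l {x′}
          (λ { (∣.divides x″ refl) → p²∤x (∣.divides x″ (trans (ℤ.*-assoc x″ (+ p) (+ p)) (cong (x″ *_) (sym (ℤ.pos-* p p))))) })
          (∣ˢ-respʳ-≡ div (ℤ.*-assoc x′ (+ p) y))

  p^-mono-∣ : ∀ {a b} → a ≤ b → p ℕ.^ a ℕ.∣ p ℕ.^ b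
  p^-mono-∣ {a} {b} a≤b = subst (p ℕ.^ a ℕ.∣_)
    (trans (sym (ℕ.^-distribˡ-+-* p a (b ℕ.∸ a))) (cong (p ℕ.^_) (ℕ.m+[n∸m]≡n a≤b)))
    (ℕ.m∣m*n (p ℕ.^ (b ℕ.∸ a)))

  -- The exponent of p in n is less than n.
  cancel-nat : ∀ l n .{{_ : ℕ.NonZero n}} {y} → + (p ℕ.^ (l ℕ.+ n)) ∣ˢ + n * y → + (p ℕ.^ l) ∣ˢ y
  cancel-nat l n = go n n ℕ.≤-refl
    where
    go : ∀ b n → n ≤ b → .{{_ : ℕ.NonZero n}} → ∀ {y} → + (p ℕ.^ (l ℕ.+ n)) ∣ˢ + n * y → + (p ℕ.^ l) ∣ˢ y
    go (suc b) (suc k) (s≤s k≤b) {y} div with p ℕ.∣? suc k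
    ... | no p∤n = ∣.∣-trans (∣.∣ᵤ⇒∣ (p^-mono-∣ (ℕ.m≤m+n l (suc k)))) (cancel-unit (l ℕ.+ suc k) {+ suc k} (p∤n ∘ ∣.∣⇒∣ᵤ) div)
    ... | yes (ℕ.divides zero ())
    ... | yes (ℕ.divides n′@(suc _) n≡n′p) =
            go b n′ (ℕ.≤-trans n′≤k k≤b) (∣.∣-trans (∣.∣ᵤ⇒∣ (p^-mono-∣ (ℕ.+-monoʳ-≤ l n′≤k))) (∣.*-cancelˡ-∣ (+ p)
              (subst (_∣ˢ + p * (+ n′ * y)) (trans (cong (λ i → + (p ℕ.^ i)) (ℕ.+-suc l k)) (p^suc (l ℕ.+ k)))
                (∣ˢ-respʳ-≡ div (trans (cong (λ i → + i * y) n≡n′p)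
                  (trans (cong (_* y) (ℤ.pos-* n′ p)) (move (+ n′) (+ p) y)))))))
      where
      n′≤k : n′ ≤ k
      n′≤k = ℕ.s≤s⁻¹ (subst (n′ <_) (sym n≡n′p) (ℕ.m<m*n n′ p (ℕ.nonTrivial⇒n>1 p {{prime⇒nonTrivial p-prime}})))
      move : ∀ n p y → n * p * y ≡ p * (n * y)
      move = solve-∀

  module Descent (l : ℕ) (B : ℕ) (pˡ∣B : + (p ℕ.^ l) ∣ˢ + B) (a : ℤ) where

    -- At the index B - u the factor n - a of the recurrence is -(a + u) modulo B, so its
    -- divisibility by p or p² can be read off from a + u.
    neg-shift : ∀ n t → n ℕ.+ suc t ≡ B → + n - a ≡ + B - (a + + suc t)
    neg-shift n t refl = trans (rearrange (+ n) a (+ suc t)) (cong (_- (a + + suc t)) (sym (ℤ.pos-+ n (suc t))))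
      where
      rearrange : ∀ n a t → n - a ≡ n + t - (a + t)
      rearrange = solve-∀

    private
      b-[b-x]≡x : ∀ b x → b - (b - x) ≡ x
      b-[b-x]≡x = solve-∀

    transfer : ∀ {k} → k ∣ˢ + B → ∀ n t → n ℕ.+ suc t ≡ B → k ∣ˢ + n - a → k ∣ˢ a + + suc t
    transfer k∣B n t eq d = ∣ˢ-respʳ-≡ (∣.∣m∣n⇒∣m-n k∣B (∣ˢ-respʳ-≡ d (neg-shift n t eq))) (b-[b-x]≡x (+ B) _)

    -- At n = B - 1 the recurrence carries the factor n + 1 = B, and this is the source of the whole
    -- power pˡ.
    first : ∀ n → n ℕ.+ 1 ≡ B → + (p ℕ.^ l) ∣ˢ (+ n - a) * E a n
    first n refl = ∣ˢ-respʳ-≡ (∣.∣m⇒∣m*n (E a (suc n)) (subst (λ b → + (p ℕ.^ l) ∣ˢ + b) (ℕ.+-comm n 1) pˡ∣B))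
      (E-recurrence a n)

    next : ∀ c n → + (p ℕ.^ l) ∣ˢ c * E a (suc n) → + (p ℕ.^ l) ∣ˢ (+ n - a) * (c * E a n)
    next c n d = ∣ˢ-respʳ-≡ (∣.∣n⇒∣m*n (+ suc n) d) (trans (swap (+ suc n) c (E a (suc n)))
      (trans (cong (c *_) (E-recurrence a n)) (swap c (+ n - a) (E a n))))
      where
      swap : ∀ x y z → x * (y * z) ≡ y * (x * z)
      swap = solve-∀

    -- Each downward step only has to cancel n - a, which is prime to p because a + 1, ..., a + t +
    -- 1 are.
    descend-unit : + p ∣ˢ + B → ∀ t n → n ℕ.+ suc t ≡ B →
      (∀ u → 1 ≤ u → u ≤ suc t → ¬ (+ p ∣ˢ a + + u)) → + (p ℕ.^ l) ∣ˢ E a n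
    descend-unit p∣B t n eq units = cancel-unit l {+ n - a}
      (units (suc t) (s≤s z≤n) ℕ.≤-refl ∘ transfer p∣B n t eq) (step t n eq units)
      where
      step : ∀ t n → n ℕ.+ suc t ≡ B → (∀ u → 1 ≤ u → u ≤ suc t → ¬ (+ p ∣ˢ a + + u)) →
        + (p ℕ.^ l) ∣ˢ (+ n - a) * E a n
      step zero    n eq _ = first n eq
      step (suc t) n eq units = ∣ˢ-respʳ-≡ (∣.∣n⇒∣m*n (+ suc n) (descend-unit p∣B t (suc n)
        (trans (sym (ℕ.+-suc n (suc t))) eq) (λ u 1≤u u≤ → units u 1≤u (ℕ.m≤n⇒m≤1+n u≤)))) (E-recurrence a n)

    -- Among the factors a + 1, …, a + t with t < p at most one is divisible by p.
    descend-one : + p ∣ˢ + B → + (p ℕ.* p) ∣ˢ + B → ∀ t n → n ℕ.+ suc t ≡ B → suc t < p →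
      (∀ u → 1 ≤ u → u ≤ suc t → ¬ (+ (p ℕ.* p) ∣ˢ a + + u)) → + (p ℕ.^ l) ∣ˢ + p * E a n
    descend-one p∣B p²∣B t n eq t<p p²∤ with go t n eq t<p p²∤
      where
      -- Either no factor p has been lost so far, or exactly one has been conceded, at the step
      -- whose factor is a + (u + 1).
      State : ℕ → ℕ → Set
      State t n = (+ (p ℕ.^ l) ∣ˢ E a n) ⊎
        ((+ (p ℕ.^ l) ∣ˢ + p * E a n) × ∃ λ u → u ≤ t × + p ∣ˢ a + + suc u)
      after-units : ∀ t n → n ℕ.+ suc t ≡ B → ¬ (+ (p ℕ.* p) ∣ˢ a + + suc t) →
        + (p ℕ.^ l) ∣ˢ (+ n - a) * E a n → State t n
      after-units t n eq p²∤ d with + p ∣.∣? + n - a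
      ... | no p∤  = inj₁ (cancel-unit l p∤ d)
      ... | yes p∣ = inj₂ (cancel-one l (p²∤ ∘ transfer p²∣B n t eq) d , t , ℕ.≤-refl , transfer p∣B n t eq p∣)
      go : ∀ t n → n ℕ.+ suc t ≡ B → suc t < p →
        (∀ u → 1 ≤ u → u ≤ suc t → ¬ (+ (p ℕ.* p) ∣ˢ a + + u)) → State t n
      go zero n eq _ p²∤ = after-units 0 n eq (p²∤ 1 ℕ.≤-refl ℕ.≤-refl) (first n eq)
      go (suc t) n eq t<p p²∤ with go t (suc n) (trans (sym (ℕ.+-suc n (suc t))) eq)
        (ℕ.<-trans ℕ.≤-refl t<p) (λ u 1≤u u≤ → p²∤ u 1≤u (ℕ.m≤n⇒m≤1+n u≤))
      ... | inj₁ d = after-units (suc t) n eq (p²∤ (suc (suc t)) (s≤s z≤n) ℕ.≤-refl)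
              (∣ˢ-respʳ-≡ (∣.∣n⇒∣m*n (+ suc n) d) (E-recurrence a n))
      ... | inj₂ (d , u , u≤t , p∣a+u) =
              inj₂ (cancel-unit l p∤ (next (+ p) n d) , u , ℕ.m≤n⇒m≤1+n u≤t , p∣a+u)
        where
        p∤ : ¬ (+ p ∣ˢ + n - a)
        -- Two such multiples of p would differ by t - u + 1, which lies strictly between 0 and p.
        p∤ p∣ = ℕ.>⇒∤ (ℕ.≤-<-trans (s≤s (ℕ.m∸n≤m t u)) (ℕ.<-trans ℕ.≤-refl t<p))
          (∣.∣⇒∣ᵤ (∣ˢ-respʳ-≡ (∣.∣m∣n⇒∣m-n (transfer p∣B n (suc t) eq p∣) p∣a+u) difference))
          where
          difference : a + + suc (suc t) - (a + + suc u) ≡ + suc (t ℕ.∸ u)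
          difference = trans (cancel a (+ suc (suc t)) (+ suc u)) (trans (ℤ.[+m]-[+n]≡m⊖n (suc (suc t)) (suc u))
            (trans (ℤ.⊖-≥ (s≤s (ℕ.m≤n⇒m≤1+n u≤t))) (cong +_ (ℕ.+-∸-assoc 1 u≤t))))
            where
            cancel : ∀ a x y → a + x - (a + y) ≡ x - y
            cancel = solve-∀
    ... | inj₁ d       = ∣.∣n⇒∣m*n (+ p) d
    ... | inj₂ (d , _) = d

-- Odd prime powers and pentagonal numbers.

1+2*-* : ∀ {a b} → (∃ λ k → a ≡ 1 ℕ.+ 2 ℕ.* k) → (∃ λ k → b ≡ 1 ℕ.+ 2 ℕ.* k) → ∃ λ k → a ℕ.* b ≡ 1 ℕ.+ 2 ℕ.* k
1+2*-* (k , refl) (l , refl) = k ℕ.+ l ℕ.+ 2 ℕ.* (k ℕ.* l) , expand k l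
  where
  expand : ∀ k l → (1 ℕ.+ 2 ℕ.* k) ℕ.* (1 ℕ.+ 2 ℕ.* l) ≡ 1 ℕ.+ 2 ℕ.* (k ℕ.+ l ℕ.+ 2 ℕ.* (k ℕ.* l))
  expand = ℕ-Solver.solve-∀

1+2*-^ : ∀ {a} → (∃ λ k → a ≡ 1 ℕ.+ 2 ℕ.* k) → ∀ n → ∃ λ k → a ℕ.^ n ≡ 1 ℕ.+ 2 ℕ.* k
1+2*-^ odd zero    = 0 , refl
1+2*-^ odd (suc n) = 1+2*-* odd (1+2*-^ odd n)

odd-prime : ∀ {p} → Prime p → p ≢ 2 → ∃ λ k → p ≡ 1 ℕ.+ 2 ℕ.* k
odd-prime {p} p-prime p≢2 with p ℕ.% 2 in p%2 | ℕ.m%n<n p 2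
... | 0           | _ = ⊥-elim ([ (λ ()) , p≢2 ∘ sym ]′ (prime⇒irreducible p-prime (ℕ.m%n≡0⇒n∣m p 2 p%2)))
... | 1           | _ = p ℕ./ 2 , trans (ℕ.m≡m%n+[m/n]*n p 2) (cong₂ ℕ._+_ p%2 (ℕ.*-comm (p ℕ./ 2) 2))
... | suc (suc _) | s≤s (s≤s ())

e₅-closed : ∀ n → 2 ℕ.* e₅ n ≡ suc n ℕ.* (3 ℕ.* n ℕ.+ 2)
e₅-closed n = trans (ℕ.*-distribˡ-+ 2 (e n) _) (trans (cong (ℕ._+ 2 ℕ.* (1 ℕ.+ (n ℕ.+ n))) (e-closed n)) (step n))
  where
  step : ∀ n → n ℕ.* (3 ℕ.* n ℕ.+ 1) ℕ.+ 2 ℕ.* (1 ℕ.+ (n ℕ.+ n)) ≡ suc n ℕ.* (3 ℕ.* n ℕ.+ 2)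
  step = ℕ-Solver.solve-∀

half : ∀ {a b} → 2 ℕ.* a ≡ b → b ℕ./ 2 ≡ a
half {a} refl = trans (cong (ℕ._/ 2) (ℕ.*-comm 2 a)) (ℕ.m*n/n≡m a 2)

-- The values of `e` are the pentagonal numbers at indices ≤ 0, those of `e₅` the ones at positive
-- indices.
e-pent : ∀ n → ∃ λ k → pent k ≡ + e n
e-pent zero    = + 0 , refl
e-pent (suc n) = -[1+ n ] , cong +_ (half (e-closed (suc n)))

e₅-pent : ∀ n → ∃ λ k → pent k ≡ + e₅ n
e₅-pent n = + suc n , cong +_ (half (trans (e₅-closed n) (cong (suc n ℕ.*_) (3n+2 n))))
  where
  3n+2 : ∀ n → 3 ℕ.* n ℕ.+ 2 ≡ n ℕ.+ (suc n ℕ.+ (suc n ℕ.+ 0))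
  3n+2 = ℕ-Solver.solve-∀

e-square : ∀ n → 24 ℕ.* e n ℕ.+ 1 ≡ (6 ℕ.* n ℕ.+ 1) ℕ.* (6 ℕ.* n ℕ.+ 1)
e-square n = trans (cong (ℕ._+ 1) (trans (ℕ.*-assoc 12 2 (e n)) (cong (12 ℕ.*_) (e-closed n)))) (square n)
  where
  square : ∀ n → 12 ℕ.* (n ℕ.* (3 ℕ.* n ℕ.+ 1)) ℕ.+ 1 ≡ (6 ℕ.* n ℕ.+ 1) ℕ.* (6 ℕ.* n ℕ.+ 1)
  square = ℕ-Solver.solve-∀

e₅-square : ∀ n → 24 ℕ.* e₅ n ℕ.+ 1 ≡ (6 ℕ.* n ℕ.+ 5) ℕ.* (6 ℕ.* n ℕ.+ 5)
e₅-square n = trans (cong (ℕ._+ 1) (trans (ℕ.*-assoc 12 2 (e₅ n)) (cong (12 ℕ.*_) (e₅-closed n)))) (square n)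
  where
  square : ∀ n → 12 ℕ.* (suc n ℕ.* (3 ℕ.* n ℕ.+ 2)) ℕ.+ 1 ≡ (6 ℕ.* n ℕ.+ 5) ℕ.* (6 ℕ.* n ℕ.+ 5)
  square = ℕ-Solver.solve-∀

-- All that is used about a single theta term with exponent x and coefficient w up to sign; both
-- families satisfy it.
PentagonalRoot : ℕ → ℕ → Set
PentagonalRoot x w = (∃ λ k → pent k ≡ + x) × (24 ℕ.* x ℕ.+ 1 ≡ w ℕ.* w)

-- Divisibility of `ξ` from divisibility of the single theta terms.

module _ {p : ℕ} (p-prime : Prime p) where
  open PrimeDivisibility p-prime

  -- By absorption the coefficient at n ≥ 1, multiplied by n, is a multiple of a. Dividing by n
  -- costs fewer than n ≤ D factors p, for which the exponent l + D makes room.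
  E-periodic : ∀ l D a → + (p ℕ.^ (l ℕ.+ D)) ∣ˢ a → ∀ n → n ≤ D → + (p ℕ.^ l) ∣ˢ E a n - oneS n
  E-periodic l D a div zero    n≤D = ∣.divides (+ 0) (cong (_- + 1) (E-head a))
  E-periodic l D a div (suc n) n≤D = subst (+ (p ℕ.^ l) ∣ˢ_) (sym (ℤ.+-identityʳ _))
    (cancel-nat l (suc n) (∣ˢ-respʳ-≡ (∣.∣m⇒∣m*n (E (a - + 1) n) (∣.∣m⇒∣-m (∣.∣-trans weaken div)))
      (trans (cong (λ b → - b * E (a - + 1) n) (sym 1+[a-1]≡a))
        (trans (sym (E-absorption (a - + 1) n)) (cong (λ b → + suc n * E b (suc n)) 1+[a-1]≡a)))))
    where
    1+[a-1]≡a : + 1 + (a - + 1) ≡ a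
    1+[a-1]≡a = cancel a
      where
      cancel : ∀ a → + 1 + (a - + 1) ≡ a
      cancel = solve-∀
    weaken : + (p ℕ.^ (l ℕ.+ suc n)) ∣ˢ + (p ℕ.^ (l ℕ.+ D))
    weaken = ∣.∣ᵤ⇒∣ (p^-mono-∣ (ℕ.+-monoʳ-≤ l n≤D))

  p∤4 : p ≢ 2 → ¬ (+ p ∣ˢ + 4)
  p∤4 p≢2 p∣4 = p≢2 (ℕ.≤-antisym (ℕ.∣⇒≤ ([ ∣.∣⇒∣ᵤ , ∣.∣⇒∣ᵤ ]′ (euclid (+ 2) (+ 2) p∣4)))
    (ℕ.nonTrivial⇒n>1 p {{prime⇒nonTrivial p-prime}}))

  p∤24 : 5 ≤ p → ¬ (+ p ∣ˢ + 24)
  p∤24 5≤p p∣24 with euclid (+ 4) (+ 6) p∣24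
  ... | inj₁ p∣4 = ℕ.>⇒∤ 5≤p (∣.∣⇒∣ᵤ p∣4)
  ... | inj₂ p∣6 with euclid (+ 2) (+ 3) p∣6
  ...   | inj₁ p∣2 = ℕ.>⇒∤ (ℕ.≤-trans (s≤s (s≤s (s≤s z≤n))) 5≤p) (∣.∣⇒∣ᵤ p∣2)
  ...   | inj₂ p∣3 = ℕ.>⇒∤ (ℕ.≤-trans (s≤s (s≤s (s≤s (s≤s z≤n)))) 5≤p) (∣.∣⇒∣ᵤ p∣3)

  module _ (r s : ℤ) where
    -- The period of q is taken to be p^(l+D). It is odd since p ≠ 2, and for the same reason the
    -- factor 4 of the strange identity cancels.
    ξ-divisible-by-power : p ≢ 2 → ∀ l D →
      (∀ x w → PentagonalRoot x w → + (p ℕ.^ l) ∣ˢ + w * E (s + r * + x) D) →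
      (+ (p ℕ.^ l)) ∣ ξ r s D
    ξ-divisible-by-power p≢2 l D terms with 1+2*-^ (odd-prime p-prime p≢2) (l ℕ.+ D)
    ... | k , N≡1+2k = ∣.∣⇒∣ᵤ (cancel-unit l (p∤4 p≢2) (ξ-divisible s k
          (congruent (E-periodic l D (r * + (1 ℕ.+ 2 ℕ.* k))
            (∣.∣n⇒∣m*n r (∣.∣-reflexive (cong +_ N≡1+2k)))))
          (λ n → terms (e n) (6 ℕ.* n ℕ.+ 1) (e-pent n , e-square n))
          (λ n → terms (e₅ n) (6 ℕ.* n ℕ.+ 5) (e₅-pent n , e₅-square n))))
      where open Modulo (+ (p ℕ.^ l)) D r

    residue : ℤ → ℕ
    residue a = a ℤ.%ℕ p

    residue-spec : ∀ a → + p ∣ˢ a - + residue a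
    residue-spec a = ∣.divides (a ℤ./ℕ p) (trans (cong (_- + residue a) (ℤ.a≡a%ℕn+[a/ℕn]*n a p)) (cancel (+ residue a) _))
      where
      cancel : ∀ x y → x + y - x ≡ y
      cancel = solve-∀

    residue∈S : ∀ k → InS p r s (residue (s + r * pent k))
    residue∈S k = ℤ.n%ℕd<d a p , k , ∣.∣⇒∣ᵤ (∣ˢ-respʳ-≡ (∣.∣m⇒∣-m (residue-spec a)) (rearrange s (r * pent k) (+ residue a)))
      where
      a = s + r * pent k
      rearrange : ∀ s b i → - (s + b - i) ≡ i - s - b
      rearrange = solve-∀

    -- The number a + u is congruent to `residue a` + u, which lies between 1 and M + (p - 1 - M) =
    -- p - 1.
    units : ∀ {M j} → M < p → j ≤ p ∸ 1 ∸ M → ∀ a → residue a ≤ M → ∀ u → 1 ≤ u → u ≤ j → ¬ (+ p ∣ˢ a + + u)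
    units {M} {j} M<p j≤ a i≤M (suc u) (s≤s _) u≤j p∣a+u =
      ℕ.>⇒∤ {residue a ℕ.+ suc u} {{ℕ.>-nonZero (ℕ.<-≤-trans (s≤s z≤n) (ℕ.m≤n+m (suc u) (residue a)))}}
        (begin-strict
          residue a ℕ.+ suc u    ≤⟨ ℕ.+-mono-≤ i≤M (ℕ.≤-trans u≤j j≤) ⟩
          M ℕ.+ (p ∸ 1 ∸ M)      ≡⟨ ℕ.m+[n∸m]≡n (ℕ.<⇒≤pred M<p) ⟩
          p ∸ 1                  <⟨ ℕ.≤-reflexive (ℕ.suc-pred p) ⟩
          p                      ∎)
        (∣.∣⇒∣ᵤ (∣ˢ-respʳ-≡ (∣.∣m∣n⇒∣m-n p∣a+u (residue-spec a)) (cancel a (+ residue a) (+ suc u))))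
      where
      open ℕ.≤-Reasoning
      cancel : ∀ a i u → a + u - (a - i) ≡ i + u
      cancel = solve-∀

    j<p : ∀ {j M} → j ≤ p ∸ 1 ∸ M → j < p
    j<p {M = M} j≤ = ℕ.≤-<-trans (ℕ.≤-trans j≤ (ℕ.m∸n≤m (p ∸ 1) M)) (ℕ.≤-reflexive (ℕ.suc-pred p))

    p∣p^ : ∀ l m → + p ∣ˢ + (p ℕ.^ suc l ℕ.* m)
    p∣p^ l m = ∣.∣ᵤ⇒∣ (ℕ.∣-trans (ℕ.m∣m*n (p ℕ.^ l)) (ℕ.m∣m*n m))

    -- The modulus p divides the positive number being reduced, so this number exceeds j < p and the
    -- truncated subtraction is a true one.
    index : ∀ l m t → 1 ≤ m → suc t < p → p ℕ.^ suc l ℕ.* m ∸ suc t ℕ.+ suc t ≡ p ℕ.^ suc l ℕ.* m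
    index l (suc m) t _ t<p = ℕ.m∸n+n≡m (ℕ.<⇒≤ (ℕ.<-≤-trans t<p
      (ℕ.∣⇒≤ {{ℕ.m*n≢0 _ (suc m) {{ℕ.m^n≢0 p (suc l)}}}} (∣.∣⇒∣ᵤ (p∣p^ l (suc m))))))

    unit-term : ∀ {M t} → M < p → suc t ≤ p ∸ 1 ∸ M → ∀ l m → 1 ≤ m → ∀ a → residue a ≤ M →
      + (p ℕ.^ suc l) ∣ˢ E a (p ℕ.^ suc l ℕ.* m ∸ suc t)
    unit-term {M} {t} M<p j≤ l m 1≤m a i≤M =
      Descent.descend-unit (suc l) (p ℕ.^ suc l ℕ.* m) (∣.∣ᵤ⇒∣ (ℕ.m∣m*n m)) a (p∣p^ l m)
        t _ (index l m t 1≤m (j<p {suc t} {M} j≤)) (units M<p j≤ a i≤M)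

    -- For p = 2 a value j ≥ 1 in the range forces M = 0. Then s and s + r, belonging to the
    -- pentagonal numbers 0 and 1, are both even.
    p≡2⇒p∣r : p ≡ 2 → ∀ {M} → (∀ t → InS p r s t → t ≤ M) → ∀ {j} → 1 ≤ j → j ≤ p ∸ 1 ∸ M → + p ∣ˢ r
    p≡2⇒p∣r refl {zero} bound _ _ = ∣ˢ-respʳ-≡ (∣.∣m∣n⇒∣m-n (divisible (+ 1)) (divisible (+ 0))) (cancel s r)
      where
      cancel : ∀ s r → s + r * + 1 - (s + r * + 0) ≡ r
      cancel = solve-∀
      divisible : ∀ k → + p ∣ˢ s + r * pent k
      divisible k = ∣ˢ-respʳ-≡ (residue-spec a) (trans (cong (λ i → a - + i) (ℕ.n≤0⇒n≡0 (bound _ (residue∈S k)))) (ℤ.+-identityʳ a))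
        where a = s + r * pent k
    p≡2⇒p∣r refl {suc zero} bound (s≤s _) ()
    p≡2⇒p∣r refl {suc (suc _)} bound (s≤s _) ()

    -- The exceptional residue class i₀.

    module SpecialResidue (p∤r : ¬ (+ p ∣ˢ r)) (5≤p : 5 ≤ p) {d d₀ : ℕ}
      (d<p : d < p) (d≢p-1 : d ≢ p ∸ 1) (d₀<p : d₀ < p)
      (digits : + (p ℕ.* p) ∣ˢ + 24 * s - r - + 24 * + (d₀ ℕ.+ d ℕ.* p))
      (x w : ℕ) (24x+1≡w² : 24 ℕ.* x ℕ.+ 1 ≡ w ℕ.* w) where

      a : ℤ
      a = s + r * + x

      square : + 24 * + x + + 1 ≡ + w * + w
      square = trans (cong (_+ + 1) (sym (ℤ.pos-* 24 x))) (trans (cong +_ 24x+1≡w²) (ℤ.pos-* w w))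

      -- As 24 i₀ ≡ 24 s - r, the congruence a ≡ i₀ says that p divides 24 a - (24 s - r) = r (24 x
      -- + 1) = r w².
      root : ∀ {i₀} → + p ∣ˢ + 24 * (+ i₀ - s) + r → residue a ≡ i₀ → + p ∣ˢ + w
      root special refl = [ ⊥-elim ∘ p∤r , (λ p∣w² → [ id , id ]′ (euclid (+ w) (+ w) p∣w²)) ]′
        (euclid r (+ w * + w) (∣ˢ-respʳ-≡ (∣.∣m∣n⇒∣m+n special (∣.∣n⇒∣m*n (+ 24) (residue-spec a)))
          (trans (collect s r (+ x) (+ residue a)) (cong (r *_) square))))
        where
        collect : ∀ s r x i → + 24 * (i - s) + r + + 24 * (s + r * x - i) ≡ r * (+ 24 * x + + 1)
        collect = solve-∀

      -- Since d ≤ p - 2, adding u < p to the two-digit number causes no carry out of its second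
      -- digit.
      small : ∀ {u} → u < p → d₀ ℕ.+ d ℕ.* p ℕ.+ u < p ℕ.* p
      small {u} u<p = begin-strict
        d₀ ℕ.+ d ℕ.* p ℕ.+ u     <⟨ ℕ.+-mono-< (ℕ.+-monoˡ-< (d ℕ.* p) d₀<p) u<p ⟩
        p ℕ.+ d ℕ.* p ℕ.+ p      ≡⟨ ℕ.+-comm (p ℕ.+ d ℕ.* p) p ⟩
        (2 ℕ.+ d) ℕ.* p          ≤⟨ ℕ.*-monoˡ-≤ p (ℕ.≤-trans (s≤s (ℕ.≤∧≢⇒< (ℕ.<⇒≤pred d<p) d≢p-1)) (ℕ.≤-reflexive (ℕ.suc-pred p))) ⟩
        p ℕ.* p                  ∎
        where open ℕ.≤-Reasoning

      -- a ≡ s - r / 24 (mod p²), so p² ∣ a + u with u < p would make its second digit p - 1.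
      p²∤a+u : + p ∣ˢ + w → ∀ u → 1 ≤ u → u < p → ¬ (+ (p ℕ.* p) ∣ˢ a + + u)
      p²∤a+u p∣w (suc u) _ u<p div = ℕ.>⇒∤ {Y ℕ.+ suc u} {{ℕ.>-nonZero (ℕ.<-≤-trans (s≤s z≤n) (ℕ.m≤n+m (suc u) Y))}}
        (small u<p) (∣.∣⇒∣ᵤ (∣ˢ-respʳ-≡ (∣.∣m∣n⇒∣m-n div p²∣a-Y) (cancel a (+ Y) (+ suc u))))
        where
        Y = d₀ ℕ.+ d ℕ.* p
        cancel : ∀ a y u → a + u - (a - y) ≡ y + u
        cancel = solve-∀
        collect : ∀ s r x y → + 24 * s - r - + 24 * y + r * (+ 24 * x + + 1) ≡ + 24 * (s + r * x - y)
        collect = solve-∀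
        p²∣w² : + (p ℕ.* p) ∣ˢ + w * + w
        p²∣w² = ∣ˢ-respʳ-≡ (∣.∣ᵤ⇒∣ (ℕ.*-pres-∣ (∣.∣⇒∣ᵤ p∣w) (∣.∣⇒∣ᵤ p∣w))) (ℤ.pos-* w w)
        p^2≡p*p : + (p ℕ.^ 2) ≡ + (p ℕ.* p)
        p^2≡p*p = cong (λ k → + (p ℕ.* k)) (ℕ.*-identityʳ p)
        p²∣a-Y : + (p ℕ.* p) ∣ˢ a - + Y
        p²∣a-Y = subst (_∣ˢ a - + Y) p^2≡p*p (cancel-unit 2 (p∤24 5≤p) (subst (_∣ˢ + 24 * (a - + Y)) (sym p^2≡p*p)
          (∣ˢ-respʳ-≡ (∣.∣m∣n⇒∣m+n digits (∣.∣n⇒∣m*n r (subst (+ (p ℕ.* p) ∣ˢ_) (sym square) p²∣w²)))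
            (collect s r (+ x) (+ Y)))))

      -- The factor p of w makes up for the one that `descend-one` may lose.
      special-term : + p ∣ˢ + w → ∀ {t} → suc t < p → ∀ l m → 1 ≤ m →
        + (p ℕ.^ suc l) ∣ˢ + w * E a (p ℕ.^ suc l ℕ.* m ∸ suc t)
      -- Modulo p itself the factor of w is enough. The descent proper starts with modulus p², where
      -- p² divides the starting index as `descend-one` demands.
      special-term p∣w {t} t<p zero m 1≤m = ∣.∣m⇒∣m*n _ (subst (_∣ˢ + w) (cong +_ (sym (ℕ.*-identityʳ p))) p∣w)
      special-term p∣w@(∣.divides w′ w≡w′p) {t} t<p (suc l) m 1≤m = ∣ˢ-respʳ-≡
        (∣.∣n⇒∣m*n w′ (Descent.descend-one (2 ℕ.+ l) (p ℕ.^ (2 ℕ.+ l) ℕ.* m) (∣.∣ᵤ⇒∣ (ℕ.m∣m*n m)) a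
          (p∣p^ (suc l) m) (∣.∣ᵤ⇒∣ p²∣B) t n (index (suc l) m t 1≤m t<p) t<p
          (λ u 1≤u u≤ → p²∤a+u p∣w u 1≤u (ℕ.≤-<-trans u≤ t<p))))
        (trans (sym (ℤ.*-assoc w′ (+ p) (E a n))) (cong (_* E a n) (sym w≡w′p)))
        where
        n = p ℕ.^ (2 ℕ.+ l) ℕ.* m ∸ suc t
        p²∣B : p ℕ.* p ℕ.∣ p ℕ.^ (2 ℕ.+ l) ℕ.* m
        p²∣B = ℕ.∣-trans (ℕ.*-monoʳ-∣ p (ℕ.m∣m*n (p ℕ.^ l))) (ℕ.m∣m*n m)

theorem4 : (p : ℕ) → Prime p → (r s : ℤ) → ¬ ((+ p) ∣ r) →
    ((M : ℕ) → IsMax (InS p r s) M →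
    (j : ℕ) → 1 ≤ j → j ≤ p ∸ 1 ∸ M → Conclusion p r s j)
    ×
    (5 ≤ p → (d : ℕ) → IsDigit1 p (+ 24 * s - r) (+ 24) d → d ≢ p ∸ 1 →
    (i0 : ℕ) → IsI0 p r s i0 →
    (M : ℕ) → IsMax (InS* p r s i0) M →
    (j : ℕ) → 1 ≤ j → j ≤ p ∸ 1 ∸ M → Conclusion p r s j)
theorem4 p p-prime r s p∤r = generic , special
  where
  generic : (M : ℕ) → IsMax (InS p r s) M → (j : ℕ) → 1 ≤ j → j ≤ p ∸ 1 ∸ M → Conclusion p r s j
  generic M ((M<p , _) , bound) (suc t) 1≤j j≤ m (suc l) 1≤m _ =
    ξ-divisible-by-power p-prime r s
      -- For p = 2 an admissible j would contradict the assumption on r.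
      (λ p≡2 → p∤r (∣.∣⇒∣ᵤ (p≡2⇒p∣r p-prime r s p≡2 bound 1≤j j≤))) (suc l) (p ℕ.^ suc l ℕ.* m ∸ suc t)
      (λ { x w ((k , pent≡x) , _) → ∣.∣n⇒∣m*n (+ w) (unit-term p-prime r s M<p j≤ l m 1≤m (s + r * + x)
        (bound _ (subst (λ y → InS p r s (residue p-prime r s (s + r * y))) pent≡x (residue∈S p-prime r s k)))) })
  special : 5 ≤ p → (d : ℕ) → IsDigit1 p (+ 24 * s - r) (+ 24) d → d ≢ p ∸ 1 →
    (i0 : ℕ) → IsI0 p r s i0 → (M : ℕ) → IsMax (InS* p r s i0) M →
    (j : ℕ) → 1 ≤ j → j ≤ p ∸ 1 ∸ M → Conclusion p r s j
  special 5≤p d (d<p , d₀ , d₀<p , digits) d≢p-1 i₀ (_ , i₀-spec) M (((M<p , _) , _) , bound) (suc t) 1≤j j≤ m (suc l) 1≤m _ =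
    ξ-divisible-by-power p-prime r s (λ { refl → ℕ.<⇒≱ 5≤p (s≤s (s≤s z≤n)) }) (suc l) (p ℕ.^ suc l ℕ.* m ∸ suc t) term
    where
    term : ∀ x w → PentagonalRoot x w → + (p ℕ.^ suc l) ∣ˢ + w * E (s + r * + x) (p ℕ.^ suc l ℕ.* m ∸ suc t)
    term x w ((k , pent≡x) , 24x+1≡w²) with residue p-prime r s (s + r * + x) ℕ.≟ i₀
    -- Outside the class of i₀ the residue belongs to S*, hence is at most M, and the descent loses
    -- no factor p.
    ... | no ≢i₀ = ∣.∣n⇒∣m*n (+ w) (unit-term p-prime r s M<p j≤ l m 1≤m (s + r * + x)
          (bound _ (subst (λ y → InS p r s (residue p-prime r s (s + r * y))) pent≡x (residue∈S p-prime r s k) , ≢i₀)))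
    ... | yes ≡i₀ = special-term (root (∣.∣ᵤ⇒∣ i₀-spec) ≡i₀) (j<p p-prime r s {suc t} {M} j≤) l m 1≤m
      where open SpecialResidue p-prime r s (p∤r ∘ ∣.∣⇒∣ᵤ) 5≤p d<p d≢p-1 d₀<p (∣.∣ᵤ⇒∣ digits) x w 24x+1≡w²
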